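{- Let $R(\mathbf{x},\mathbf{x}')$ be a balanced difference bounds constraint over $N$ variables, let $n\ge1$, and let $\rho$ be a path in $\mathcal{G}_R^n$ between extremal vertices. Then there exists a normalized path $\rho'$ in $\mathcal{G}_R^n$ that is compatible with $\rho$.
   Context: Variables range over $\mathbb{Z}$; $\mathbf{x}=\{x_1,\dots,x_N\}$, $\mathbf{x}'$ its primed copy. A difference bounds constraint is a finite conjunction of atoms $u-v\le c$, $c\in\mathbb{Z}$; its constraint graph has the variables as vertices and an edge $u\xrightarrow{c}v$ per atom $u-v\le c$. $R$ is balanced if $x_i-x_j\le c$ is an atom of $R$ iff $x_i'-x_j'\le c$ is. For $p\in\mathbb{Z}$ let $x_i^{(p)}$ be fresh copies of $x_i$; the vertex $x_i^{(p)}$ has position $p$. The $n$-times unfolding $\mathcal{G}_R^n$ is the union over $p=0,\dots,n-1$ of the constraint graphs of $R(\mathbf{x}^{(p)},\mathbf{x}^{(p+1)})$; its extremal vertices are those at positions $0$ and $n$. A path is a sequence of vertices consecutive ones joined by edges (at least one vertex); its weight is the sum of edge weights, $\mathrm{positions}(\rho)$ is the set of positions of its vertices; a subpath is a contiguous subsequence. A path $\rho'$ is compatible with $\rho$ if both have the same first vertex and the same last vertex and the weight of $\rho'$ is at most that of $\rho$. A corner is a path with at least one edge whose first and last vertex have the same position $k_0$; it is a right corner of extent $d\ge0$ if its set of positions is $\{k_0,\dots,k_0+d\}$, a left corner of extent $d$ if it is $\{k_0-d,\dots,k_0\}$. A corner is long if its extent exceeds $N^2$. A path $\rho$ in $\mathcal{G}_R^n$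 between extremal vertices is normalized if none of its subpaths $\theta$ with $\mathrm{positions}(\theta)\subseteq\{N^2,\dots,n-N^2\}$ is a long corner. -}

module Defs where

open import Data.Nat using (ℕ; zero; suc; _≤_; _<_; _*_; _∸_)
open import Data.Integer using (ℤ) renaming (_+_ to _+ℤ_; _≤_ to _≤ℤ_)
open import Data.Fin using (Fin)
open import Data.List using (List; []; _∷_)
open import Data.List.Membership.Propositional using (_∈_)
open import Data.Product using (Σ; _×_; _,_; ∃)
open import Data.Sum using (_⊎_)
open import Relation.Binary.PropositionalEquality using (_≡_)
open import Relation.Nullary using (¬_)
open import Data.Empty using (⊥)
open import Data.Unit using (⊤)

-- Variables of R(x, x'): an unprimed x_i or a primed x_i'.
data Var (N : ℕ) : Set where
  unp : Fin N → Var N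
  pr  : Fin N → Var N

-- An atom  u - v ≤ c  is represented by the triple (u , v , c).
Atom : ℕ → Set
Atom N = Var N × Var N × ℤ

-- A difference bounds constraint: a finite conjunction (list) of atoms.
DBC : ℕ → Set
DBC N = List (Atom N)

Balanced : ∀ {N} → DBC N → Set
Balanced {N} R = ∀ (i j : Fin N) (c : ℤ) →
  (((unp i , unp j , c) ∈ R) → ((pr i , pr j , c) ∈ R)) ×
  (((pr i , pr j , c) ∈ R) → ((unp i , unp j , c) ∈ R))

-- Vertices of the unfolding: x_i^(p) is (i , p); its position is p.
Vertex : ℕ → Set
Vertex N = Fin N × ℕ

pos : ∀ {N} → Vertex N → ℕ
pos (_ , p) = p

-- Instantiation of R(x^(p), x^(p+1)).
inst : ∀ {N} → ℕ → Var N → Vertex N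
inst p (unp i) = i , p
inst p (pr i)  = i , suc p

Edge : ∀ {N} → DBC N → ℕ → Vertex N → ℤ → Vertex N → Set
Edge {N} R n u c v =
  Σ ℕ λ p → p < n × Σ (Var N) λ a → Σ (Var N) λ b →
    ((a , b , c) ∈ R) × inst p a ≡ u × inst p b ≡ v

-- Paths in G_R^n (at least one vertex; the single vertex must be a vertex of G_R^n).
data Path {N : ℕ} (R : DBC N) (n : ℕ) : Vertex N → Vertex N → Set where
  []  : ∀ {u} → pos u ≤ n → Path R n u u
  _∷_ : ∀ {u c v w} → Edge R n u c v → Path R n v w → Path R n u w

infixr 5 _∷_

weight : ∀ {N} {R : DBC N} {n u v} → Path R n u v → ℤ
weight ([] _) = Data.Integer.+ 0
weight (_∷_ {c = c} _ ρ) = c +ℤ weight ρ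

positions : ∀ {N} {R : DBC N} {n u v} → Path R n u v → List ℕ
positions ([] {u} _) = pos u ∷ []
positions (_∷_ {u = u} _ ρ) = pos u ∷ positions ρ

_++ₚ_ : ∀ {N} {R : DBC N} {n u v w} → Path R n u v → Path R n v w → Path R n u w
[] _ ++ₚ σ = σ
(e ∷ ρ) ++ₚ σ = e ∷ (ρ ++ₚ σ)

infixr 5 _++ₚ_

Subpath : ∀ {N} {R : DBC N} {n u v a b} → Path R n u v → Path R n a b → Set
Subpath {N} {R} {n} {u} {v} {a} {b} θ ρ =
  Σ (Path R n a u) λ α → Σ (Path R n v b) λ β → ρ ≡ α ++ₚ (θ ++ₚ β)

HasEdge : ∀ {N} {R : DBC N} {n u v} → Path R n u v → Set
HasEdge ([] _) = ⊥
HasEdge (_ ∷ _) = ⊤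

Corner : ∀ {N} {R : DBC N} {n u v} → Path R n u v → Set
Corner {u = u} {v = v} ρ = HasEdge ρ × pos u ≡ pos v

RightCorner : ∀ {N} {R : DBC N} {n u v} → ℕ → Path R n u v → Set
RightCorner {u = u} d ρ = Corner ρ ×
  (∀ p → ((p ∈ positions ρ) → (pos u ≤ p × p ≤ pos u Data.Nat.+ d)) ×
         ((pos u ≤ p × p ≤ pos u Data.Nat.+ d) → (p ∈ positions ρ)))

-- Left corner of extent d: positions(ρ) = {k0 - d, ..., k0} (as a set of integers, so d ≤ k0).
LeftCorner : ∀ {N} {R : DBC N} {n u v} → ℕ → Path R n u v → Set
LeftCorner {u = u} d ρ = Corner ρ × d ≤ pos u ×
  (∀ p → ((p ∈ positions ρ) → (p ≤ pos u × pos u ≤ p Data.Nat.+ d)) ×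
         ((p ≤ pos u × pos u ≤ p Data.Nat.+ d) → (p ∈ positions ρ)))

LongCorner : ∀ {N} {R : DBC N} {n u v} → Path R n u v → Set
LongCorner {N} ρ = ∃ λ d → N * N < d × (RightCorner d ρ ⊎ LeftCorner d ρ)

InMiddle : ℕ → ℕ → List ℕ → Set
InMiddle N n ps = ∀ p → p ∈ ps → (N * N ≤ p × p Data.Nat.+ N * N ≤ n)

Normalized : ∀ {N} {R : DBC N} {n a b} → Path R n a b → Set
Normalized {N} {R} {n} ρ =
  ∀ u v (θ : Path R n u v) → Subpath θ ρ → InMiddle N n (positions θ) → ¬ LongCorner θ

Extremal : ∀ {N} → ℕ → Vertex N → Set
Extremal n u = pos u ≡ 0 ⊎ pos u ≡ n

Compatible : ∀ {N} {R : DBC N} {n u v} → Path R n u v → Path R n u v → Set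
Compatible ρ' ρ = weight ρ' ≤ℤ weight ρ

{-# OPTIONS --safe #-}
module Submission where

-- A long corner inside the middle contains a peak (or a valley): three vertices x, y, z
-- in this order with y more than N² above (below) both x and z. It suffices to remove
-- these, and valleys are peaks of the walk reflected by p ↦ n - p. Extending a normalized
-- walk by one edge at the front, consider its shortest prefix with a peak. Of the N² + 1
-- topmost levels of this prefix, two, k and k + s, share the states in which they are last
-- left before the summit and first reached after it. If the cycle pair σ, σ′ between
-- these levels has nonnegative cost, cutting it out gives a shorter walk without new
-- peaks and valleys. Otherwise repeating it lowers the cost and pushes the summit, in
-- steps s ≤ N², out of the middle; the walk then splits at the summit into two parts,
-- neither of which has a peak or valley in the middle.

open import Data.Nat using (ℕ; zero; suc; _+_; _*_; _∸_; _≤_; _<_; z≤n; s≤s; _≤?_; _<?_)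
open import Data.Nat.Properties
open import Data.List using (List; []; _∷_; _++_; [_]; map)
open import Data.List.Properties using (++-assoc; map-++)
open import Data.List.Membership.Propositional using (_∈_)
open import Data.List.Membership.Propositional.Properties using (∈-++⁺ˡ; ∈-++⁺ʳ; ∈-++⁻; ∈-map⁺)
open import Data.List.Relation.Unary.All as All using (All; []; _∷_)
open import Data.List.Relation.Unary.All.Properties using (++⁺; ++⁻ˡ; ++⁻ʳ; map⁺)
open import Data.List.Relation.Unary.Any using (here; there)
open import Data.Product using (Σ; ∃; _×_; _,_; proj₁; proj₂)
open import Data.Sum using (_⊎_; inj₁; inj₂; [_,_]′)
open import Data.Unit using (⊤)
open import Data.Fin using (Fin; toℕ; combine)
open import Data.Fin.Properties using (pigeonhole; combine-injective; toℕ<n)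
open import Data.Integer using (ℤ; 0ℤ) renaming (_+_ to _+ℤ_; _≤_ to _≤ℤ_)
import Data.Integer.Properties as ℤP
open import Data.Integer.Tactic.RingSolver using (solve-∀)
open import Data.Empty using (⊥; ⊥-elim)
open import Relation.Nullary using (¬_; Dec; yes; no)
open import Relation.Nullary.Decidable using (map′; _×-dec_; _⊎-dec_)
open import Relation.Binary.PropositionalEquality
  using (_≡_; _≢_; refl; sym; trans; cong; cong₂; subst; subst₂; module ≡-Reasoning)
open import Defs

private variable
  x y z w : ℕ
  l U V : List ℕ

-- Bad triples in lists of positions.

module Windows (K n : ℕ) where

  Mid : ℕ → Set
  Mid p = K ≤ p × p + K ≤ n

  Mid? : ∀ p → Dec (Mid p)
  Mid? p = (K ≤? p) ×-dec (p + K ≤? n)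

  -- P and S locate entries in the longest prefix, respectively suffix, of a
  -- list that lies in the middle; Tri x y z l says that x, y, z occur in this
  -- order inside one contiguous middle block of l.
  data P₁ (z : ℕ) : List ℕ → Set where
    here  : Mid z → P₁ z (z ∷ l)
    there : Mid w → P₁ z l → P₁ z (w ∷ l)

  data P₂ (y z : ℕ) : List ℕ → Set where
    here  : Mid y → P₁ z l → P₂ y z (y ∷ l)
    there : Mid w → P₂ y z l → P₂ y z (w ∷ l)

  data S₁ (x : ℕ) : List ℕ → Set where
    here  : Mid x → All Mid l → S₁ x (x ∷ l)
    there : S₁ x l → S₁ x (w ∷ l)

  data S₂ (x y : ℕ) : List ℕ → Set where
    here  : Mid x → All Mid l → y ∈ l → S₂ x y (x ∷ l)
    there : S₂ x y l → S₂ x y (w ∷ l)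

  data Tri (x y z : ℕ) : List ℕ → Set where
    here  : Mid x → P₂ y z l → Tri x y z (x ∷ l)
    there : Tri x y z l → Tri x y z (w ∷ l)

  Peak Valley : ℕ → ℕ → ℕ → Set
  Peak   x y z = K + x < y × K + z < y
  Valley x y z = K + y < x × K + y < z

  -- `Bad` is weaker than containing a long corner in the middle: `x` and `z` may lie on different
  -- levels. This leaves room to trade one entry for another when a block of the list is replaced.
  Bad Good : List ℕ → Set
  Bad l = ∃ λ x → ∃ λ y → ∃ λ z → Tri x y z l × (Peak x y z ⊎ Valley x y z)
  Good l = ¬ Bad l

  -- `Q` is a parameter so that the nested searches can fix the entries already chosen.
  P₁? : {Q : ℕ → Set} → (∀ z → Dec (Q z)) → ∀ l → Dec (∃ λ z → P₁ z l × Q z)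
  P₁? Q? [] = no λ { (_ , () , _) }
  P₁? Q? (w ∷ l) = map′
    (λ { (m , inj₁ q) → _ , here m , q
       ; (m , inj₂ (_ , p , q)) → _ , there m p , q })
    (λ { (_ , here m , q) → m , inj₁ q
       ; (_ , there m p , q) → m , inj₂ (_ , p , q) })
    (Mid? w ×-dec (Q? w ⊎-dec P₁? Q? l))

  P₂? : {Q : ℕ → ℕ → Set} → (∀ y z → Dec (Q y z)) → ∀ l → Dec (∃ λ y → ∃ λ z → P₂ y z l × Q y z)
  P₂? Q? [] = no λ { (_ , _ , () , _) }
  P₂? Q? (w ∷ l) = map′
    (λ { (m , inj₁ (_ , p , q)) → _ , _ , here m p , q
       ; (m , inj₂ (_ , _ , p , q)) → _ , _ , there m p , q })
    (λ { (_ , _ , here m p , q) → m , inj₁ (_ , p , q)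
       ; (_ , _ , there m p , q) → m , inj₂ (_ , _ , p , q) })
    (Mid? w ×-dec (P₁? (Q? w) l ⊎-dec P₂? Q? l))

  Tri? : {Q : ℕ → ℕ → ℕ → Set} → (∀ x y z → Dec (Q x y z)) → ∀ l →
    Dec (∃ λ x → ∃ λ y → ∃ λ z → Tri x y z l × Q x y z)
  Tri? Q? [] = no λ { (_ , _ , _ , () , _) }
  Tri? Q? (w ∷ l) = map′
    (λ { (inj₁ (m , _ , _ , p , q)) → _ , _ , _ , here m p , q
       ; (inj₂ (_ , _ , _ , t , q)) → _ , _ , _ , there t , q })
    (λ { (_ , _ , _ , here m p , q) → inj₁ (m , _ , _ , p , q)
       ; (_ , _ , _ , there t , q) → inj₂ (_ , _ , _ , t , q) })
    ((Mid? w ×-dec P₂? (Q? w) l) ⊎-dec Tri? Q? l)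

  Bad? : ∀ l → Dec (Bad l)
  Bad? = Tri? λ x y z →
    ((K + x <? y) ×-dec (K + z <? y)) ⊎-dec ((K + y <? x) ×-dec (K + y <? z))

  -- Triples and concatenation.

  P₁-∈ : P₁ z U → z ∈ U
  P₁-∈ (here _) = here refl
  P₁-∈ (there _ p) = there (P₁-∈ p)

  P₁-++⁺ˡ : P₁ z U → P₁ z (U ++ V)
  P₁-++⁺ˡ (here m) = here m
  P₁-++⁺ˡ (there m p) = there m (P₁-++⁺ˡ p)

  P₁-++⁺ʳ : All Mid U → P₁ z V → P₁ z (U ++ V)
  P₁-++⁺ʳ [] p = p
  P₁-++⁺ʳ (m ∷ ms) p = there m (P₁-++⁺ʳ ms p)

  ∈-P₁ : All Mid U → z ∈ U → P₁ z U
  ∈-P₁ (m ∷ ms) (here refl) = here m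
  ∈-P₁ (m ∷ ms) (there i) = there m (∈-P₁ ms i)

  P₁-++⁻ : ∀ U → P₁ z (U ++ V) → P₁ z U ⊎ (All Mid U × P₁ z V)
  P₁-++⁻ [] p = inj₂ ([] , p)
  P₁-++⁻ (_ ∷ U) (here m) = inj₁ (here m)
  P₁-++⁻ (_ ∷ U) (there m p) with P₁-++⁻ U p
  ... | inj₁ q = inj₁ (there m q)
  ... | inj₂ (ms , q) = inj₂ (m ∷ ms , q)

  P₂-∈ : P₂ y z U → y ∈ U × z ∈ U
  P₂-∈ (here _ p) = here refl , there (P₁-∈ p)
  P₂-∈ (there _ p) with P₂-∈ p
  ... | i , j = there i , there j

  P₂-++⁺ˡ : P₂ y z U → P₂ y z (U ++ V)
  P₂-++⁺ˡ (here m p) = here m (P₁-++⁺ˡ p)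
  P₂-++⁺ˡ (there m p) = there m (P₂-++⁺ˡ p)

  P₂-++⁺ʳ : All Mid U → P₂ y z V → P₂ y z (U ++ V)
  P₂-++⁺ʳ [] p = p
  P₂-++⁺ʳ (m ∷ ms) p = there m (P₂-++⁺ʳ ms p)

  P₂-++⁺ : All Mid U → y ∈ U → P₁ z V → P₂ y z (U ++ V)
  P₂-++⁺ (m ∷ ms) (here refl) p = here m (P₁-++⁺ʳ ms p)
  P₂-++⁺ (m ∷ ms) (there i) p = there m (P₂-++⁺ ms i p)

  P₂-++⁻ : ∀ U → P₂ y z (U ++ V) →
    P₂ y z U ⊎ (All Mid U × y ∈ U × P₁ z V) ⊎ (All Mid U × P₂ y z V)
  P₂-++⁻ [] p = inj₂ (inj₂ ([] , p))
  P₂-++⁻ (_ ∷ U) (here m p) with P₁-++⁻ U p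
  ... | inj₁ q = inj₁ (here m q)
  ... | inj₂ (ms , q) = inj₂ (inj₁ (m ∷ ms , here refl , q))
  P₂-++⁻ (_ ∷ U) (there m p) with P₂-++⁻ U p
  ... | inj₁ q = inj₁ (there m q)
  ... | inj₂ (inj₁ (ms , i , q)) = inj₂ (inj₁ (m ∷ ms , there i , q))
  ... | inj₂ (inj₂ (ms , q)) = inj₂ (inj₂ (m ∷ ms , q))

  S₁-∈ : S₁ x U → x ∈ U
  S₁-∈ (here _ _) = here refl
  S₁-∈ (there s) = there (S₁-∈ s)

  ∈-S₁ : All Mid U → x ∈ U → S₁ x U
  ∈-S₁ (m ∷ ms) (here refl) = here m ms
  ∈-S₁ (m ∷ ms) (there i) = there (∈-S₁ ms i)

  S₁-++⁻ : ∀ U → S₁ x (U ++ V) → (S₁ x U × All Mid V) ⊎ S₁ x V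
  S₁-++⁻ [] s = inj₂ s
  S₁-++⁻ (_ ∷ U) (here m ms) = inj₁ (here m (++⁻ˡ U ms) , ++⁻ʳ U ms)
  S₁-++⁻ (_ ∷ U) (there s) with S₁-++⁻ U s
  ... | inj₁ (t , a) = inj₁ (there t , a)
  ... | inj₂ t = inj₂ t

  S₂-S₁ : S₂ x y U → S₁ x U
  S₂-S₁ (here m ms _) = here m ms
  S₂-S₁ (there s) = there (S₂-S₁ s)

  S₂-∈ : S₂ x y U → x ∈ U × y ∈ U
  S₂-∈ (here _ _ i) = here refl , there i
  S₂-∈ (there s) with S₂-∈ s
  ... | i , j = there i , there j

  S₂-++⁻ : ∀ U → S₂ x y (U ++ V) →
    (S₂ x y U × All Mid V) ⊎ (S₁ x U × All Mid V × y ∈ V) ⊎ S₂ x y V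
  S₂-++⁻ [] s = inj₂ (inj₂ s)
  S₂-++⁻ (_ ∷ U) (here m ms i) with ∈-++⁻ U i
  ... | inj₁ j = inj₁ (here m (++⁻ˡ U ms) j , ++⁻ʳ U ms)
  ... | inj₂ j = inj₂ (inj₁ (here m (++⁻ˡ U ms) , ++⁻ʳ U ms , j))
  S₂-++⁻ (_ ∷ U) (there s) with S₂-++⁻ U s
  ... | inj₁ (t , a) = inj₁ (there t , a)
  ... | inj₂ (inj₁ (t , a)) = inj₂ (inj₁ (there t , a))
  ... | inj₂ (inj₂ t) = inj₂ (inj₂ t)

  Tri-++⁺ˡ : Tri x y z U → Tri x y z (U ++ V)
  Tri-++⁺ˡ (here m p) = here m (P₂-++⁺ˡ p)
  Tri-++⁺ˡ (there t) = there (Tri-++⁺ˡ t)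

  Tri-++⁺ʳ : ∀ U → Tri x y z V → Tri x y z (U ++ V)
  Tri-++⁺ʳ [] t = t
  Tri-++⁺ʳ (_ ∷ U) t = there (Tri-++⁺ʳ U t)

  Tri-++⁺₂₁ : S₂ x y U → P₁ z V → Tri x y z (U ++ V)
  Tri-++⁺₂₁ (here m ms i) p = here m (P₂-++⁺ ms i p)
  Tri-++⁺₂₁ (there s) p = there (Tri-++⁺₂₁ s p)

  Tri-++⁺₁₂ : S₁ x U → P₂ y z V → Tri x y z (U ++ V)
  Tri-++⁺₁₂ (here m ms) p = here m (P₂-++⁺ʳ ms p)
  Tri-++⁺₁₂ (there s) p = there (Tri-++⁺₁₂ s p)

  data TriSplit (x y z : ℕ) (U V : List ℕ) : Set where
    left : Tri x y z U → TriSplit x y z U V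
    right : Tri x y z V → TriSplit x y z U V
    two-one : S₂ x y U → P₁ z V → TriSplit x y z U V
    one-two : S₁ x U → P₂ y z V → TriSplit x y z U V

  Tri-++⁻ : ∀ U → Tri x y z (U ++ V) → TriSplit x y z U V
  Tri-++⁻ [] t = right t
  Tri-++⁻ (_ ∷ U) (here m p) with P₂-++⁻ U p
  ... | inj₁ q = left (here m q)
  ... | inj₂ (inj₁ (ms , i , q)) = two-one (here m ms i) q
  ... | inj₂ (inj₂ (ms , q)) = one-two (here m ms) q
  Tri-++⁻ (_ ∷ U) (there t) with Tri-++⁻ U t
  ... | left s = left (there s)
  ... | right s = right s
  ... | two-one s p = two-one (there s) p
  ... | one-two s p = one-two (there s) p

  Tri-∈ : Tri x y z U → x ∈ U × y ∈ U × z ∈ U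
  Tri-∈ (here _ p) with P₂-∈ p
  ... | i , j = here refl , there i , there j
  Tri-∈ (there t) with Tri-∈ t
  ... | i , j , k = there i , there j , there k

  Good-++⁻ˡ : ∀ U V → Good (U ++ V) → Good U
  Good-++⁻ˡ U V g (_ , _ , _ , t , q) = g (_ , _ , _ , Tri-++⁺ˡ t , q)

  Good-++⁻ʳ : ∀ U → Good (U ++ V) → Good V
  Good-++⁻ʳ U g (_ , _ , _ , t , q) = g (_ , _ , _ , Tri-++⁺ʳ U t , q)

  -- A triple never straddles an entry outside the middle.
  Good-glue : ∀ U {h V} → ¬ Mid h → Good U → Good (h ∷ V) → Good (U ++ h ∷ V)
  Good-glue U ¬m gU gV (_ , _ , _ , t , q) with Tri-++⁻ U t
  ... | left s = gU (_ , _ , _ , s , q)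
  ... | right s = gV (_ , _ , _ , s , q)
  ... | two-one _ (here m) = ¬m m
  ... | two-one _ (there m _) = ¬m m
  ... | one-two _ (here m _) = ¬m m
  ... | one-two _ (there m _) = ¬m m

  -- Replacing blocks that span levels at most `K` apart.

  Range : ℕ → ℕ → ℕ → Set
  Range k h p = k ≤ p × p ≤ h

  private variable
    k h s : ℕ

  narrow : h ≤ k + K → Range k h x → Range k h y → ¬ (K + x < y)
  narrow {h} {k} {x} {y} hk (k≤x , _) (_ , y≤h) x<y = <-irrefl refl (begin-strict
    k + K ≡⟨ +-comm k K ⟩
    K + k ≤⟨ +-monoʳ-≤ K k≤x ⟩
    K + x <⟨ x<y ⟩
    y     ≤⟨ y≤h ⟩
    h     ≤⟨ hk ⟩
    k + K ∎)
    where open ≤-Reasoning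

  -- Peaks and valleys both put `x` and `y` more than `K` apart, which is too far for the range from
  -- `k` to `h`.
  narrow-triple : h ≤ k + K → All (Range k h) U → x ∈ U → y ∈ U → ¬ (Peak x y z ⊎ Valley x y z)
  narrow-triple hk a i j (inj₁ (p , _)) = narrow hk (All.lookup a i) (All.lookup a j) p
  narrow-triple hk a i j (inj₂ (p , _)) = narrow hk (All.lookup a j) (All.lookup a i) p

  narrow-tripleʳ : h ≤ k + K → All (Range k h) U → y ∈ U → z ∈ U → ¬ (Peak x y z ⊎ Valley x y z)
  narrow-tripleʳ hk a i j (inj₁ (_ , p)) = narrow hk (All.lookup a j) (All.lookup a i) p
  narrow-tripleʳ hk a i j (inj₂ (_ , p)) = narrow hk (All.lookup a i) (All.lookup a j) p

  -- Every entry of W′ can be traded for k or for h, whichever keeps the triple bad.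
  Good-shrink : ∀ X W W′ Y → h ≤ k + K → All Mid W → k ∈ W → h ∈ W → All (Range k h) W′ →
    Good (X ++ (W ++ Y)) → Good (X ++ (W′ ++ Y))
  Good-shrink {h} {k} X W W′ Y hk mW kW hW r g (x , y , z , t , q) with Tri-++⁻ X t
  ... | left s = g (_ , _ , _ , Tri-++⁺ˡ s , q)
  ... | right s with Tri-++⁻ W′ s
  ...   | left s′ = let i , j , _ = Tri-∈ s′ in narrow-triple hk r i j q
  ...   | right s′ = g (_ , _ , _ , Tri-++⁺ʳ X (Tri-++⁺ʳ W s′) , q)
  ...   | two-one s′ _ = let i , j = S₂-∈ s′ in narrow-triple hk r i j q
  ...   | one-two s′ p with q
  ...     | inj₁ (a , b) = g (k , _ , _ , Tri-++⁺ʳ X (Tri-++⁺₁₂ (∈-S₁ mW kW) p) ,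
              inj₁ (≤-<-trans (+-monoʳ-≤ K (proj₁ (All.lookup r (S₁-∈ s′)))) a , b))
  ...     | inj₂ (a , b) = g (h , _ , _ , Tri-++⁺ʳ X (Tri-++⁺₁₂ (∈-S₁ mW hW) p) ,
              inj₂ (<-≤-trans a (proj₂ (All.lookup r (S₁-∈ s′))) , b))
  Good-shrink {h} {k} X W W′ Y hk mW kW hW r g (x , y , z , t , q) | two-one s p with P₁-++⁻ W′ p
  ... | inj₂ (_ , p′) = g (_ , _ , _ , Tri-++⁺₂₁ s (P₁-++⁺ʳ mW p′) , q)
  ... | inj₁ p′ with q
  ...   | inj₁ (a , b) = g (_ , _ , k , Tri-++⁺₂₁ s (P₁-++⁺ˡ (∈-P₁ mW kW)) ,
            inj₁ (a , ≤-<-trans (+-monoʳ-≤ K (proj₁ (All.lookup r (P₁-∈ p′)))) b))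
  ...   | inj₂ (a , b) = g (_ , _ , h , Tri-++⁺₂₁ s (P₁-++⁺ˡ (∈-P₁ mW hW)) ,
            inj₂ (a , <-≤-trans b (proj₂ (All.lookup r (P₁-∈ p′)))))
  Good-shrink {h} {k} X W W′ Y hk mW kW hW r g (x , y , z , t , q) | one-two s p with P₂-++⁻ W′ p
  ... | inj₁ p′ = let i , j = P₂-∈ p′ in narrow-tripleʳ hk r i j q
  ... | inj₂ (inj₂ (_ , p′)) = g (_ , _ , _ , Tri-++⁺₁₂ s (P₂-++⁺ʳ mW p′) , q)
  ... | inj₂ (inj₁ (_ , i , p′)) with q
  ...   | inj₁ (a , b) = g (_ , h , _ , Tri-++⁺₁₂ s (P₂-++⁺ mW hW p′) ,
            inj₁ (<-≤-trans a (proj₂ (All.lookup r i)) , <-≤-trans b (proj₂ (All.lookup r i))))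
  ...   | inj₂ (a , b) = g (_ , k , _ , Tri-++⁺₁₂ s (P₂-++⁺ mW kW p′) ,
            let k≤y = +-monoʳ-≤ K (proj₁ (All.lookup r i)) in
            inj₂ (≤-<-trans k≤y a , ≤-<-trans k≤y b))

  Range-shift : All (Range k h) U → All (Range (k + s) (h + s)) (map (_+ s) U)
  Range-shift {s = s} a = map⁺ (All.map (λ (p , q) → +-monoˡ-≤ s p , +-monoˡ-≤ s q) a)

  shift≤ : h ≤ k + K → h + s ≤ k + s + K
  shift≤ {h} {k} {s} hk = begin
    h + s       ≤⟨ +-monoˡ-≤ s hk ⟩
    k + K + s   ≡⟨ +-assoc k K s ⟩
    k + (K + s) ≡⟨ cong (k +_) (+-comm K s) ⟩
    k + (s + K) ≡⟨ +-assoc k s K ⟨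
    k + s + K   ∎
    where open ≤-Reasoning

  -- S ++ C is a climb from level k to its summit h whose part S starts and ends in
  -- the same state; it is repeated once, s levels higher.
  Good-climb : ∀ X S C → h ≤ k + K → All Mid (S ++ C) → All (Range k h) (S ++ C) → k ∈ S → h ∈ C →
    (∀ {x} → S₁ x (X ++ S) → x ≤ h) →
    Good ((X ++ S) ++ C) → Good ((X ++ S) ++ map (_+ s) (S ++ C))
  Good-climb {h} {k} {s} X S C hk mG r kS hC ub g (x , y , z , t , q)
    with Tri-++⁻ (X ++ S) t
  ... | left u = g (_ , _ , _ , Tri-++⁺ˡ u , q)
  ... | right u = let i , j , _ = Tri-∈ u in narrow-triple (shift≤ hk) (Range-shift r) i j q
  ... | one-two _ p = let i , j = P₂-∈ p in narrow-tripleʳ (shift≤ hk) (Range-shift r) i j q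
  ... | two-one u p with q
  -- The entry `z` has been raised, but `x ≤ h` shows that the old summit `h` is already high enough
  -- to close the valley.
  ...   | inj₂ (a , b) = g (_ , _ , h , Tri-++⁺₂₁ u (∈-P₁ (++⁻ʳ S mG) hC) ,
            inj₂ (a , <-≤-trans a (ub (S₂-S₁ u))))
  -- Since `z` lies at `k + s` or above, the level `k` met in `S` closes the peak instead. The entry
  -- `y` comes before `S`: it is more than `K` above `k`, hence above everything in `S`.
  ...   | inj₁ (a , b) = lower (S₂-++⁻ X u)
    where
    K+k<y : K + k < y
    K+k<y = ≤-<-trans (+-monoʳ-≤ K (≤-trans (m≤m+n k s) (proj₁ (All.lookup (Range-shift r) (P₁-∈ p))))) b
    tooHigh : y ∈ S → ⊥
    tooHigh i = narrow hk (All.lookup r (∈-++⁺ˡ kS)) (All.lookup r (∈-++⁺ˡ i)) K+k<y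
    lower : (S₂ x y X × All Mid S) ⊎ (S₁ x X × All Mid S × y ∈ S) ⊎ S₂ x y S → ⊥
    lower (inj₁ (v , _)) = g (_ , _ , k , Tri-++⁺ˡ (Tri-++⁺₂₁ v (∈-P₁ (++⁻ˡ S mG) kS)) , inj₁ (a , K+k<y))
    lower (inj₂ (inj₁ (_ , _ , i))) = tooHigh i
    lower (inj₂ (inj₂ v)) = tooHigh (proj₂ (S₂-∈ v))

  -- The time reversal of `Good-climb`: in a peak the raised entry `x` is traded for `k`, in a
  -- valley for the old summit `h`, where `ub` gives `z ≤ h`.
  Good-descend : ∀ C S Y → h ≤ k + K → All Mid (C ++ S) → All (Range k h) (C ++ S) → k ∈ S → h ∈ C →
    (∀ {z} → P₁ z (S ++ Y) → z ≤ h) →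
    Good (C ++ (S ++ Y)) → Good (map (_+ s) (C ++ S) ++ (S ++ Y))
  Good-descend {h} {k} {s} C S Y hk mG r kS hC ub g (x , y , z , t , q)
    with Tri-++⁻ (map (_+ s) (C ++ S)) t
  ... | right u = g (_ , _ , _ , Tri-++⁺ʳ C u , q)
  ... | left u = let i , j , _ = Tri-∈ u in narrow-triple (shift≤ hk) (Range-shift r) i j q
  ... | two-one u _ = let i , j = S₂-∈ u in narrow-triple (shift≤ hk) (Range-shift r) i j q
  ... | one-two u p with q
  ...   | inj₂ (a , b) = g (h , _ , _ , Tri-++⁺₁₂ (∈-S₁ (++⁻ˡ C mG) hC) p ,
            inj₂ (<-≤-trans b (ub (last p)) , b))
    where
    last : P₂ y z l → P₁ z l
    last (here m p) = there m p
    last (there m p) = there m (last p)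
  ...   | inj₁ (a , b) = lower (P₂-++⁻ S p)
    where
    K+k<y : K + k < y
    K+k<y = ≤-<-trans (+-monoʳ-≤ K (≤-trans (m≤m+n k s) (proj₁ (All.lookup (Range-shift r) (S₁-∈ u))))) a
    tooHigh : y ∈ S → ⊥
    tooHigh i = narrow hk (All.lookup r (∈-++⁺ʳ C kS)) (All.lookup r (∈-++⁺ʳ C i)) K+k<y
    lower : P₂ y z S ⊎ (All Mid S × y ∈ S × P₁ z Y) ⊎ (All Mid S × P₂ y z Y) → ⊥
    lower (inj₁ v) = tooHigh (proj₁ (P₂-∈ v))
    lower (inj₂ (inj₁ (_ , i , _))) = tooHigh i
    lower (inj₂ (inj₂ (_ , v))) =
      g (k , _ , _ , Tri-++⁺ʳ C (Tri-++⁺₁₂ (∈-S₁ (++⁻ʳ C mG) kS) v) , inj₁ (K+k<y , b))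

  -- Reflection of levels.

  Mid-mirror : x ≤ n → Mid (n ∸ x) → Mid x
  Mid-mirror {x} x≤n (a , b) =
      +-cancelˡ-≤ (n ∸ x) K x (≤-trans b (≤-reflexive (sym (m∸n+n≡m x≤n))))
    , ≤-trans (+-monoʳ-≤ x a) (≤-reflexive (m+[n∸m]≡n x≤n))

  far-mirror : x ≤ n → y ≤ n → K + (n ∸ x) < n ∸ y → K + y < x
  far-mirror {x} {y} x≤n y≤n far = +-cancelʳ-< (n ∸ x) (K + y) x (begin-strict
    K + y + (n ∸ x)   ≡⟨ +-assoc K y (n ∸ x) ⟩
    K + (y + (n ∸ x)) ≡⟨ cong (K +_) (+-comm y (n ∸ x)) ⟩
    K + (n ∸ x + y)   ≡⟨ +-assoc K (n ∸ x) y ⟨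
    K + (n ∸ x) + y   <⟨ +-monoˡ-< y far ⟩
    n ∸ y + y         ≡⟨ m∸n+n≡m y≤n ⟩
    n                 ≡⟨ m+[n∸m]≡n x≤n ⟨
    x + (n ∸ x)       ∎)
    where open ≤-Reasoning

  -- The bound `q ≤ n` makes the truncated subtraction a true reflection.
  Mirrored : ℕ → ℕ → Set
  Mirrored p q = q ≤ n × p ≡ n ∸ q

  P₁-mirror : All (_≤ n) l → P₁ z (map (n ∸_) l) → ∃ λ z′ → Mirrored z z′ × P₁ z′ l
  P₁-mirror (b ∷ _) (here m) = _ , (b , refl) , here (Mid-mirror b m)
  P₁-mirror (b ∷ bs) (there m p) with P₁-mirror bs p
  ... | _ , e , q = _ , e , there (Mid-mirror b m) q

  P₂-mirror : All (_≤ n) l → P₂ y z (map (n ∸_) l) →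
    ∃ λ y′ → ∃ λ z′ → Mirrored y y′ × Mirrored z z′ × P₂ y′ z′ l
  P₂-mirror (b ∷ bs) (here m p) with P₁-mirror bs p
  ... | _ , e , q = _ , _ , (b , refl) , e , here (Mid-mirror b m) q
  P₂-mirror (b ∷ bs) (there m p) with P₂-mirror bs p
  ... | _ , _ , d , e , q = _ , _ , d , e , there (Mid-mirror b m) q

  Tri-mirror : All (_≤ n) l → Tri x y z (map (n ∸_) l) →
    ∃ λ x′ → ∃ λ y′ → ∃ λ z′ → Mirrored x x′ × Mirrored y y′ × Mirrored z z′ × Tri x′ y′ z′ l
  Tri-mirror (b ∷ bs) (here m p) with P₂-mirror bs p
  ... | _ , _ , d , e , q = _ , _ , _ , (b , refl) , d , e , here (Mid-mirror b m) q
  Tri-mirror (b ∷ bs) (there t) with Tri-mirror bs t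
  ... | _ , _ , _ , c , d , e , q = _ , _ , _ , c , d , e , there q

  -- The middle is symmetric, and reflection exchanges peaks and valleys.
  Good-mirror : All (_≤ n) l → Good l → Good (map (n ∸_) l)
  Good-mirror bs g (_ , _ , _ , t , q) with Tri-mirror bs t
  ... | _ , _ , _ , (bx , refl) , (by , refl) , (bz , refl) , t′ with q
  ...   | inj₁ (a , b) = g (_ , _ , _ , t′ , inj₂ (far-mirror bx by a , far-mirror bz by b))
  ...   | inj₂ (a , b) = g (_ , _ , _ , t′ , inj₁ (far-mirror by bx a , far-mirror by bz b))

-- Walks, their positions and their costs.

-- For balanced R the edges of the unfolding do not depend on the position, so walks are
-- taken in the unbounded unfolding; the bound n on positions is carried separately.
record Graph (N : ℕ) : Set₁ where
  field
    Flat Up Down : Fin N → Fin N → ℤ → Set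

open Graph

opposite : ∀ {N} → Graph N → Graph N
opposite G = record { Flat = Flat G ; Up = Down G ; Down = Up G }

module Walks {N : ℕ} where

  private variable
    G G′ : Graph N
    i j : Fin N
    a b : Fin N
    p q k : ℕ
    c : ℤ
    t u v u′ v′ : Vertex N

  data Step (G : Graph N) : Vertex N → ℤ → Vertex N → Set where
    flat : Flat G i j c → Step G (i , p) c (j , p)
    up   : Up G i j c → q ≡ suc p → Step G (i , p) c (j , q)
    down : Down G i j c → p ≡ suc q → Step G (i , p) c (j , q)

  data Walk (G : Graph N) : Vertex N → Vertex N → Set where
    []  : Walk G u u
    _∷_ : Step G t c u → Walk G u v → Walk G t v

  infixr 5 _++ʷ_
  _++ʷ_ : Walk G t u → Walk G u v → Walk G t v
  [] ++ʷ β = β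
  (e ∷ α) ++ʷ β = e ∷ (α ++ʷ β)

  ++ʷ-assoc : (α : Walk G t u) (β : Walk G u v) (γ : Walk G v v′) → (α ++ʷ β) ++ʷ γ ≡ α ++ʷ (β ++ʷ γ)
  ++ʷ-assoc [] β γ = refl
  ++ʷ-assoc (e ∷ α) β γ = cong (e ∷_) (++ʷ-assoc α β γ)

  ++ʷ-[] : (α : Walk G t u) → α ++ʷ [] ≡ α
  ++ʷ-[] [] = refl
  ++ʷ-[] (e ∷ α) = cong (e ∷_) (++ʷ-[] α)

  -- `inits` omits the last vertex and `tails` the first, so that the joint of two concatenated
  -- walks is listed once.
  inits tails full : Walk G u v → List ℕ
  inits [] = []
  inits (_∷_ {t = t} _ ρ) = pos t ∷ inits ρ
  tails [] = []
  tails (_∷_ {u = u} _ ρ) = pos u ∷ tails ρ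
  full {u = u} ρ = pos u ∷ tails ρ

  cost : Walk G u v → ℤ
  cost [] = 0ℤ
  cost (_∷_ {c = c} _ ρ) = c +ℤ cost ρ

  len : Walk G u v → ℕ
  len [] = 0
  len (_ ∷ ρ) = suc (len ρ)

  inits-++ : (α : Walk G t u) {β : Walk G u v} → inits (α ++ʷ β) ≡ inits α ++ inits β
  inits-++ [] = refl
  inits-++ (_ ∷ α) = cong (_ ∷_) (inits-++ α)

  tails-++ : (α : Walk G t u) {β : Walk G u v} → tails (α ++ʷ β) ≡ tails α ++ tails β
  tails-++ [] = refl
  tails-++ (_ ∷ α) = cong (_ ∷_) (tails-++ α)

  full-++ : (α : Walk G t u) {β : Walk G u v} → full (α ++ʷ β) ≡ inits α ++ full β
  full-++ [] = refl
  full-++ (_ ∷ α) = cong (_ ∷_) (full-++ α)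

  full-∷ʳ : (α : Walk G t u) → full α ≡ inits α ++ [ pos u ]
  full-∷ʳ [] = refl
  full-∷ʳ (_ ∷ α) = cong (_ ∷_) (full-∷ʳ α)

  cost-++ : (α : Walk G t u) {β : Walk G u v} → cost (α ++ʷ β) ≡ cost α +ℤ cost β
  cost-++ [] {β} = sym (ℤP.+-identityˡ (cost β))
  cost-++ (_∷_ {c = c} _ α) {β} = trans (cong (c +ℤ_) (cost-++ α)) (sym (ℤP.+-assoc c (cost α) (cost β)))

  len-++ : (α : Walk G t u) {β : Walk G u v} → len (α ++ʷ β) ≡ len α + len β
  len-++ [] = refl
  len-++ (_ ∷ α) = cong suc (len-++ α)

  split-All : ∀ {P : ℕ → Set} (α : Walk G t u) {β : Walk G u v} → All P (full (α ++ʷ β)) → All P (full α) × All P (full β)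
  split-All [] ps@(p ∷ _) = p ∷ [] , ps
  split-All (_ ∷ α) (p ∷ ps) = let as , bs = split-All α ps in p ∷ as , bs

  start-∈ : (α : Walk G t u) → pos t ≢ pos u → pos t ∈ inits α
  start-∈ [] ne = ⊥-elim (ne refl)
  start-∈ (_ ∷ _) _ = here refl

  end-∈-full : (α : Walk G t u) → pos u ∈ full α
  end-∈-full [] = here refl
  end-∈-full (_ ∷ α) = there (end-∈-full α)

  end-∈ : (α : Walk G t u) → pos t ≢ pos u → pos u ∈ tails α
  end-∈ [] ne = ⊥-elim (ne refl)
  end-∈ (_ ∷ α) _ = end-∈-full α

  joint-∈ : (α : Walk G t u) {β : Walk G u v} → pos u ∈ full (α ++ʷ β)
  joint-∈ α = subst (_ ∈_) (sym (full-++ α)) (∈-++⁺ʳ (inits α) (here refl))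

  nonempty : (α : Walk G t u) → pos t ≢ pos u → 0 < len α
  nonempty [] ne = ⊥-elim (ne refl)
  nonempty (_ ∷ _) _ = s≤s z≤n

  -- A change of level forces an edge in `α`, so the joint survives the removal of the first vertex.
  -- `A` is chosen before `β`, which allows `β` to be exchanged later.
  tails-via : (α : Walk G t u) → pos t ≢ pos u →
    Σ (List ℕ) λ A → ∀ {v} (β : Walk G u v) → tails (α ++ʷ β) ≡ A ++ full β
  tails-via [] ne = ⊥-elim (ne refl)
  tails-via (_ ∷ α) _ = inits α , λ _ → full-++ α

  inits-via : (β : Walk G t u) → pos t ≢ pos u →
    Σ (List ℕ) λ C → ∀ {v} (α : Walk G v t) → inits (α ++ʷ β) ≡ full α ++ C
  inits-via [] ne = ⊥-elim (ne refl)
  inits-via β@(_ ∷ β′) _ = inits β′ , λ α →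
    trans (inits-++ α) (trans (sym (++-assoc (inits α) [ _ ] _)) (cong (_++ inits β′) (sym (full-∷ʳ α))))

  step-level : Step G u c v → pos v ≤ suc (pos u) × pos u ≤ suc (pos v)
  step-level (flat _) = n≤1+n _ , n≤1+n _
  step-level (up _ refl) = ≤-refl , m≤n⇒m≤1+n (n≤1+n _)
  step-level (down _ refl) = m≤n⇒m≤1+n (n≤1+n _) , ≤-refl

  compare-splits : (α : Walk G t u) {β : Walk G u v} (α′ : Walk G t u′) {β′ : Walk G u′ v} →
    α ++ʷ β ≡ α′ ++ʷ β′ →
    (Σ (Walk G u u′) λ γ → α′ ≡ α ++ʷ γ × β ≡ γ ++ʷ β′) ⊎
    (Σ (Walk G u′ u) λ γ → α ≡ α′ ++ʷ γ × β′ ≡ γ ++ʷ β)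
  compare-splits [] α′ eq = inj₁ (α′ , refl , eq)
  compare-splits (e ∷ α) [] eq = inj₂ (e ∷ α , refl , sym eq)
  compare-splits {u = u} {v} {u′} (e ∷ α) {β} (e′ ∷ α′) {β′} eq = cancel refl refl eq
    where
    -- With variables in place of the two concatenations the equation can be matched, which
    -- identifies `e` with `e′`.
    cancel : ∀ {ρ ρ′} → ρ ≡ α ++ʷ β → ρ′ ≡ α′ ++ʷ β′ → e ∷ ρ ≡ e′ ∷ ρ′ →
      (Σ (Walk _ u u′) λ γ → e′ ∷ α′ ≡ e ∷ (α ++ʷ γ) × β ≡ γ ++ʷ β′) ⊎
      (Σ (Walk _ u′ u) λ γ → e ∷ α ≡ e′ ∷ (α′ ++ʷ γ) × β′ ≡ γ ++ʷ β)
    cancel p q refl with compare-splits α α′ (trans (sym p) q)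
    ... | inj₁ (γ , r , s) = inj₁ (γ , cong (e ∷_) r , s)
    ... | inj₂ (γ , r , s) = inj₂ (γ , cong (e ∷_) r , s)

  -- Summits and visits to a level.

  record SummitSplit (ρ : Walk G u v) : Set where
    constructor summit
    field
      {top} : Vertex N
      ascent : Walk G u top
      descent : Walk G top v
      split≡ : ρ ≡ ascent ++ʷ descent
      below : All (_≤ pos top) (full ρ)

  summitSplit : (ρ : Walk G u v) → SummitSplit ρ
  summitSplit [] = summit [] [] refl (≤-refl ∷ [])
  summitSplit {u = u} (e ∷ ρ) with summitSplit ρ
  ... | summit {top} α β refl bs with pos u ≤? pos top
  ...   | yes u≤ = summit (e ∷ α) β refl (u≤ ∷ bs)
  ...   | no u≰ = summit [] (e ∷ ρ) refl (≤-refl ∷ All.map (λ b → ≤-trans b (<⇒≤ (≰⇒> u≰))) bs)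

  -- Of being last only this is recorded: from there on the walk stays at level `k` or above.
  record LastVisit (k : ℕ) (ρ : Walk G u v) (a : Fin N) : Set where
    constructor lastly
    field
      before : Walk G u (a , k)
      after : Walk G (a , k) v
      split≡ : ρ ≡ before ++ʷ after
      above : All (k ≤_) (full after)

  record FirstVisit (k : ℕ) (ρ : Walk G u v) (b : Fin N) : Set where
    constructor firstly
    field
      before : Walk G u (b , k)
      after : Walk G (b , k) v
      split≡ : ρ ≡ before ++ʷ after
      above : All (k ≤_) (full before)

  -- A discrete intermediate value argument: a step changes the level by at most one, so a walk
  -- ending at `k` or above cannot come from below without meeting `k`.
  lastVisit : ∀ k (ρ : Walk G u v) → k ≤ pos v → ∃ (LastVisit k ρ) ⊎ All (k <_) (full ρ)
  lastVisit {u = _ , p} k [] k≤p with m≤n⇒m<n∨m≡n k≤p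
  ... | inj₁ k<p = inj₂ (k<p ∷ [])
  ... | inj₂ refl = inj₁ (_ , lastly [] [] refl (≤-refl ∷ []))
  lastVisit {u = _ , p} k (e ∷ ρ) k≤ with lastVisit k ρ k≤
  ... | inj₁ (_ , lastly α β refl as) = inj₁ (_ , lastly (e ∷ α) β refl as)
  ... | inj₂ as@(a ∷ _) with m≤n⇒m<n∨m≡n (≤-pred (≤-trans a (proj₁ (step-level e))))
  ...   | inj₁ k<p = inj₂ (k<p ∷ as)
  ...   | inj₂ refl = inj₁ (_ , lastly [] (e ∷ ρ) refl (≤-refl ∷ All.map <⇒≤ as))

  firstVisit : ∀ k (ρ : Walk G u v) → k ≤ pos u → ∃ (FirstVisit k ρ) ⊎ All (k <_) (full ρ)
  firstVisit k ρ k≤ with m≤n⇒m<n∨m≡n k≤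
  ... | inj₂ refl = inj₁ (_ , firstly [] ρ refl (≤-refl ∷ []))
  firstVisit k [] _ | inj₁ k<p = inj₂ (k<p ∷ [])
  firstVisit k (e ∷ ρ) k≤ | inj₁ k<p with firstVisit k ρ (≤-pred (≤-trans k<p (proj₂ (step-level e))))
  ... | inj₁ (_ , firstly α β refl as) = inj₁ (_ , firstly (e ∷ α) β refl (k≤ ∷ as))
  ... | inj₂ as = inj₂ (k<p ∷ as)

  -- Translated and reflected copies of walks.

  record Copy (f : ℕ → ℕ) (ρ : Walk G u v) (ρ′ : Walk G′ u′ v′) : Set where
    field
      start≡ : pos u′ ≡ f (pos u)
      inits≡ : inits ρ′ ≡ map f (inits ρ)
      tails≡ : tails ρ′ ≡ map f (tails ρ)
      cost≡  : cost ρ′ ≡ cost ρ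
      len≡   : len ρ′ ≡ len ρ

    full≡ : full ρ′ ≡ map f (full ρ)
    full≡ = cong₂ _∷_ start≡ tails≡

  open Copy public

  at : (ℕ → ℕ) → Vertex N → Vertex N
  at f (i , p) = i , f p

  -- `P` delimits the positions at which `f` has to respect steps: `_∸ s` and `n ∸_` do so where the
  -- truncated subtraction is exact.
  copy : ∀ f {P : ℕ → Set} →
    (∀ {t c u} → P (pos t) → P (pos u) → Step G t c u → Step G′ (at f t) c (at f u)) →
    (ρ : Walk G u v) → All P (full ρ) → Σ (Walk G′ (at f u) (at f v)) (Copy f ρ)
  copy f step [] _ = [] , record { start≡ = refl ; inits≡ = refl ; tails≡ = refl ; cost≡ = refl ; len≡ = refl }
  copy f step (_∷_ {c = c} e ρ) (p ∷ ps) with copy f step ρ ps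
  ... | ρ′ , C = step p (All.head ps) e ∷ ρ′ , record
    { start≡ = refl ; inits≡ = cong (_ ∷_) (inits≡ C) ; tails≡ = cong (_ ∷_) (tails≡ C)
    ; cost≡ = cong (c +ℤ_) (cost≡ C) ; len≡ = cong suc (len≡ C) }

  lift : ∀ s (ρ : Walk G u v) → Σ (Walk G (at (_+ s) u) (at (_+ s) v)) (Copy (_+ s) ρ)
  lift s ρ = copy (_+ s) {λ _ → ⊤} (λ _ _ → step) ρ (All.universal _ _)
    where
    step : Step G t c u → Step G (at (_+ s) t) c (at (_+ s) u)
    step (flat e) = flat e
    step (up e refl) = up e refl
    step (down e refl) = down e refl

  lower : ∀ {s} (ρ : Walk G (a , k + s) (b , k + s)) → All (s ≤_) (full ρ) →
    Σ (Walk G (a , k) (b , k)) (Copy (_∸ s) ρ)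
  lower {G = G} {a} {k} {b} {s} ρ ps =
    subst (λ p → Σ (Walk G (a , p) (b , p)) (Copy (_∸ s) ρ)) (m+n∸n≡m k s) (copy (_∸ s) step ρ ps)
    where
    step : s ≤ pos t → s ≤ pos u → Step G t c u → Step G (at (_∸ s) t) c (at (_∸ s) u)
    step _ _ (flat e) = flat e
    step s≤ _ (up e refl) = up e (+-∸-assoc 1 s≤)
    step _ s≤ (down e refl) = down e (+-∸-assoc 1 s≤)

  mirror : ∀ n (ρ : Walk G u v) → All (_≤ n) (full ρ) →
    Σ (Walk (opposite G) (at (n ∸_) u) (at (n ∸_) v)) (Copy (n ∸_) ρ)
  mirror {G = G} n = copy (n ∸_) step
    where
    reach : suc p ≤ n → n ∸ p ≡ suc (n ∸ suc p)
    reach p<n = +-∸-assoc 1 p<n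
    step : pos t ≤ n → pos u ≤ n → Step G t c u → Step (opposite G) (at (n ∸_) t) c (at (n ∸_) u)
    step _ _ (flat e) = flat e
    step _ b (up e refl) = down e (reach b)
    step b _ (down e refl) = up e (reach b)

-- Repeating or cutting out a pair of cycles around a summit.

module Normalisation {N : ℕ} (n : ℕ) where

  K : ℕ
  K = N * N

  open Windows K n
  open Walks {N}

  private variable
    G : Graph N
    u v t : Vertex N
    a b i : Fin N
    k h s : ℕ

  Normalised : (G : Graph N) (u v : Vertex N) → ℤ → Set
  Normalised G u v W = Σ (Walk G u v) λ ρ → All (_≤ n) (full ρ) × cost ρ ≤ℤ W × Good (full ρ)

  -- The outcome of one repair: either the walk is finished, or it is shorter and every remaining
  -- bad triple starts at its first vertex.
  Improved : (G : Graph N) (u v : Vertex N) → ℤ → ℕ → Set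
  Improved G u v W L = Σ (Walk G u v) λ ρ → All (_≤ n) (full ρ) × cost ρ ≤ℤ W ×
    (Good (full ρ) ⊎ (Good (tails ρ) × len ρ < L))

  -- The climb σ and the descent σ′ are repeated until the summit has left the middle;
  -- as s ≤ K, it does so before passing n.
  pump : ∀ fuel (x : Walk G u (a , k)) (σ : Walk G (a , k) (a , k + s)) (τ : Walk G (a , k + s) (i , h))
    (τ′ : Walk G (i , h) (b , k + s)) (σ′ : Walk G (b , k + s) (b , k)) (y : Walk G (b , k) v) →
    n < h + fuel → h ≤ n → 0 < s → s ≤ K → K ≤ k → h ≤ k + K →
    All (Range k h) (inits σ ++ full τ) → All (Range k h) (full τ′ ++ tails σ′) →
    All (_≤ n) (inits x) → All (_≤ n) (tails y) →
    (∀ {z} → S₁ z (inits x ++ inits σ) → z ≤ h) → (∀ {z} → P₁ z (tails σ′ ++ tails y) → z ≤ h) →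
    Good ((inits x ++ inits σ) ++ full τ) → Good (full τ′ ++ (tails σ′ ++ tails y)) →
    cost σ +ℤ cost σ′ ≤ℤ 0ℤ →
    Normalised G u v (cost (x ++ʷ (σ ++ʷ (τ ++ʷ (τ′ ++ʷ (σ′ ++ʷ y))))))
  -- The fuel bounds how far the summit can still rise; once it is spent, `n < h` contradicts
  -- `h ≤ n`.
  pump zero x σ τ τ′ σ′ y f h≤n _ _ _ _ _ _ _ _ _ _ _ _ _ =
    ⊥-elim (<-irrefl refl (<-≤-trans f (≤-trans (≤-reflexive (+-identityʳ _)) h≤n)))
  pump {G = G} {u} {a} {k} {s} {i} {h} {b} {v} (suc fuel) x σ τ τ′ σ′ y
    f h≤n 0<s s≤K K≤k h≤k+K rσ rσ′ bx by ubx uby gx gy neg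
    with h + K ≤? n
  -- The summit has left the middle, so no triple straddles it and the two sides are judged
  -- separately.
  ... | no out = ρ , bounds , ℤP.≤-refl ,
    subst Good (sym shape) (Good-glue A (λ m → out (proj₂ m))
      (Good-++⁻ˡ A [ h ] (subst Good
        (trans (cong ((inits x ++ inits σ) ++_) (full-∷ʳ τ))
          (sym (++-assoc (inits x ++ inits σ) (inits τ) _))) gx))
      (subst Good (cong (h ∷_) (sym tailsD)) gy))
    where
    ρ = x ++ʷ (σ ++ʷ (τ ++ʷ (τ′ ++ʷ (σ′ ++ʷ y))))
    A = (inits x ++ inits σ) ++ inits τ
    D = τ′ ++ʷ (σ′ ++ʷ y)
    tailsD : tails D ≡ tails τ′ ++ (tails σ′ ++ tails y)
    tailsD = trans (tails-++ τ′) (cong (tails τ′ ++_) (tails-++ σ′))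
    shape : full ρ ≡ A ++ full D
    shape = begin
      full ρ                                        ≡⟨ full-++ x ⟩
      inits x ++ full (σ ++ʷ (τ ++ʷ D))             ≡⟨ cong (inits x ++_) (full-++ σ) ⟩
      inits x ++ (inits σ ++ full (τ ++ʷ D))        ≡⟨ ++-assoc (inits x) (inits σ) _ ⟨
      (inits x ++ inits σ) ++ full (τ ++ʷ D)        ≡⟨ cong ((inits x ++ inits σ) ++_) (full-++ τ) ⟩
      (inits x ++ inits σ) ++ (inits τ ++ full D)   ≡⟨ ++-assoc (inits x ++ inits σ) (inits τ) _ ⟨
      A ++ full D                                   ∎
      where open ≡-Reasoning
    low : ∀ {l} → All (Range k h) l → All (_≤ n) l
    low = All.map (λ r → ≤-trans (proj₂ r) h≤n)
    bounds : All (_≤ n) (full ρ)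
    bounds = subst (All (_≤ n)) (sym shape) (++⁺
      (++⁺ (++⁺ bx (low (++⁻ˡ (inits σ) rσ)))
        (++⁻ˡ (inits τ) (subst (All _) (full-∷ʳ τ) (low (++⁻ʳ (inits σ) rσ)))))
      (subst (All (_≤ n)) (cong (h ∷_) (sym tailsD))
        (subst (All _) (++-assoc (full τ′) (tails σ′) _) (++⁺ (low rσ′) by))))
  ... | yes h+K≤n
    with lift s σ | lift s τ | lift s τ′ | lift s σ′
  ... | σ₁ , cσ | τ₁ , cτ | τ′₁ , cτ′ | σ′₁ , cσ′ =
    -- The original cycles pass to the outer parts; the lifted copies form the new climb and descent
    -- with summit `h + s`.
    let ρ , bρ , wρ , gρ = pump fuel (x ++ʷ σ) σ₁ τ₁ τ′₁ σ′₁ (σ′ ++ʷ y)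
          (<-≤-trans f (≤-trans (≤-reflexive (+-suc h fuel))
            (≤-trans (+-monoˡ-≤ fuel (≤-trans (≤-reflexive (+-comm 1 h)) (+-monoʳ-≤ h 0<s))) ≤-refl)))
          (≤-trans (+-monoʳ-≤ h s≤K) h+K≤n) 0<s s≤K (≤-trans K≤k (m≤m+n k s)) (shift≤ h≤k+K)
          (subst (All _) (sym climb≡) (Range-shift rσ))
          (subst (All _) (sym descend≡) (Range-shift rσ′))
          (subst (All _) (sym (inits-++ x)) (++⁺ bx (low (++⁻ˡ (inits σ) rσ))))
          (subst (All _) (sym (tails-++ σ′)) (++⁺ (low (++⁻ʳ (full τ′) rσ′)) by))
          ubx′ uby′
          (subst Good (sym (trans (++-assoc (inits (x ++ʷ σ)) (inits σ₁) _) (cong₂ _++_ (inits-++ x) climb≡)))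
            (Good-climb (inits x) (inits σ) (full τ) h≤k+K (mid rσ) rσ
              (start-∈ σ k≢) (end-∈-full τ) ubx gx))
          (subst Good (trans (cong₂ _++_ (sym descend≡) (sym (tails-++ σ′))) (++-assoc (full τ′₁) _ _))
            (Good-descend (full τ′) (tails σ′) (tails y) h≤k+K (mid rσ′) rσ′
              (end-∈ σ′ (λ e → k≢ (sym e))) (here refl) uby gy))
          (subst (_≤ℤ 0ℤ) (sym (cong₂ _+ℤ_ (cost≡ cσ) (cost≡ cσ′))) neg)
    in ρ , bρ , ℤP.≤-trans wρ cheaper , gρ
    where
    k≢ : k ≢ k + s
    k≢ e = <-irrefl e (<-≤-trans (≤-reflexive (+-comm 1 k)) (+-monoʳ-≤ k 0<s))
    low : ∀ {l} → All (Range k h) l → All (_≤ n) l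
    low = All.map (λ r → ≤-trans (proj₂ r) h≤n)
    mid : ∀ {l} → All (Range k h) l → All Mid l
    mid = All.map (λ (p , q) → ≤-trans K≤k p , ≤-trans (+-monoˡ-≤ K q) h+K≤n)
    climb≡ : inits σ₁ ++ full τ₁ ≡ map (_+ s) (inits σ ++ full τ)
    climb≡ = trans (cong₂ _++_ (inits≡ cσ) (full≡ cτ)) (sym (map-++ _ (inits σ) _))
    descend≡ : full τ′₁ ++ tails σ′₁ ≡ map (_+ s) (full τ′ ++ tails σ′)
    descend≡ = trans (cong₂ _++_ (full≡ cτ′) (tails≡ cσ′)) (sym (map-++ _ (full τ′) _))
    ubx′ : ∀ {z} → S₁ z (inits (x ++ʷ σ) ++ inits σ₁) → z ≤ h + s
    ubx′ q with S₁-++⁻ (inits (x ++ʷ σ)) q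
    ... | inj₁ (q′ , _) = ≤-trans (ubx (subst (S₁ _) (inits-++ x) q′)) (m≤m+n h s)
    ... | inj₂ q′ = proj₂ (All.lookup (Range-shift (++⁻ˡ (inits σ) rσ)) (subst (_ ∈_) (inits≡ cσ) (S₁-∈ q′)))
    uby′ : ∀ {z} → P₁ z (tails σ′₁ ++ tails (σ′ ++ʷ y)) → z ≤ h + s
    uby′ q with P₁-++⁻ (tails σ′₁) q
    ... | inj₂ (_ , q′) = ≤-trans (uby (subst (P₁ _) (tails-++ σ′) q′)) (m≤m+n h s)
    ... | inj₁ q′ = proj₂ (All.lookup (Range-shift (++⁻ʳ (full τ′) rσ′)) (subst (_ ∈_) (tails≡ cσ′) (P₁-∈ q′)))
    old = cost (x ++ʷ (σ ++ʷ (τ ++ʷ (τ′ ++ʷ (σ′ ++ʷ y)))))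
    -- One repetition adds exactly the cost of the two cycles, which is at most zero.
    regroup : ∀ X S T T′ S′ Y →
      (X +ℤ S) +ℤ (S +ℤ (T +ℤ (T′ +ℤ (S′ +ℤ (S′ +ℤ Y)))))
      ≡ (S +ℤ S′) +ℤ (X +ℤ (S +ℤ (T +ℤ (T′ +ℤ (S′ +ℤ Y)))))
    regroup = solve-∀
    cheaper : cost ((x ++ʷ σ) ++ʷ (σ₁ ++ʷ (τ₁ ++ʷ (τ′₁ ++ʷ (σ′₁ ++ʷ (σ′ ++ʷ y)))))) ≤ℤ old
    cheaper rewrite cost-++ (x ++ʷ σ) {σ₁ ++ʷ (τ₁ ++ʷ (τ′₁ ++ʷ (σ′₁ ++ʷ (σ′ ++ʷ y))))}
      | cost-++ σ₁ {τ₁ ++ʷ (τ′₁ ++ʷ (σ′₁ ++ʷ (σ′ ++ʷ y)))}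
      | cost-++ τ₁ {τ′₁ ++ʷ (σ′₁ ++ʷ (σ′ ++ʷ y))}
      | cost-++ τ′₁ {σ′₁ ++ʷ (σ′ ++ʷ y)}
      | cost-++ σ′₁ {σ′ ++ʷ y}
      | cost-++ x {σ}
      | cost-++ x {σ ++ʷ (τ ++ʷ (τ′ ++ʷ (σ′ ++ʷ y)))}
      | cost-++ σ {τ ++ʷ (τ′ ++ʷ (σ′ ++ʷ y))}
      | cost-++ τ {τ′ ++ʷ (σ′ ++ʷ y)}
      | cost-++ τ′ {σ′ ++ʷ y}
      | cost-++ σ′ {y}
      | cost≡ cσ | cost≡ cτ | cost≡ cτ′ | cost≡ cσ′
      | regroup (cost x) (cost σ) (cost τ) (cost τ′) (cost σ′) (cost y)
      = ℤP.≤-trans (ℤP.+-monoˡ-≤ _ neg) (ℤP.≤-reflexive (ℤP.+-identityˡ _))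

  -- Removing `σ` and `σ′` and lowering `τ ++ʷ τ′` by `s` saves a nonnegative cost and at least one
  -- edge. The lowered block stays between `k` and `h`, and the block `ω` that it replaces meets
  -- both levels, so `Good-shrink` applies.
  shrink : (x : Walk G u (a , k)) (σ : Walk G (a , k) (a , k + s)) (τ : Walk G (a , k + s) (i , h))
    (τ′ : Walk G (i , h) (b , k + s)) (σ′ : Walk G (b , k + s) (b , k)) (y : Walk G (b , k) v) →
    pos u ≢ k → 0 < s → h ≤ k + K →
    All (Range k h) (full ((σ ++ʷ τ) ++ʷ (τ′ ++ʷ σ′))) → All Mid (full ((σ ++ʷ τ) ++ʷ (τ′ ++ʷ σ′))) →
    All (k + s ≤_) (full (τ ++ʷ τ′)) →
    let ρ = x ++ʷ (((σ ++ʷ τ) ++ʷ (τ′ ++ʷ σ′)) ++ʷ y) in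
    All (_≤ n) (full ρ) → Good (tails ρ) → 0ℤ ≤ℤ cost σ +ℤ cost σ′ →
    Improved G u v (cost ρ) (len ρ)
  shrink {G = G} {u} {a} {k} {s} {i} {h} {b} {v} x σ τ τ′ σ′ y u≢k 0<s h≤k+K rW mW high bρ gρ nonneg
    with lower (τ ++ʷ τ′) (All.map (≤-trans (m≤n+m s k)) high)
  ... | τ₁ , cτ = x ++ʷ (τ₁ ++ʷ y) , bounds , cheaper , inj₂ (good , shorter)
    where
    ω = (σ ++ʷ τ) ++ʷ (τ′ ++ʷ σ′)
    ω-assoc : ω ≡ σ ++ʷ ((τ ++ʷ τ′) ++ʷ σ′)
    ω-assoc = trans (++ʷ-assoc σ τ _) (cong (σ ++ʷ_) (sym (++ʷ-assoc τ τ′ σ′)))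
    k≢ : k ≢ k + s
    k≢ e = <-irrefl e (<-≤-trans (≤-reflexive (+-comm 1 k)) (+-monoʳ-≤ k 0<s))
    init : ∀ {P : ℕ → Set} {u v} (α : Walk G u v) → All P (full α) → All P (inits α)
    init α ps = ++⁻ˡ (inits α) (subst (All _) (full-∷ʳ α) ps)
    rτ : All (Range k h) (full (τ ++ʷ τ′))
    rτ = proj₁ (split-All (τ ++ʷ τ′) (proj₂ (split-All σ (subst (λ ω → All (Range k h) (full ω)) ω-assoc rW))))
    rτ₁ : All (Range k h) (inits τ₁)
    rτ₁ = subst (All _) (sym (inits≡ cτ)) (map⁺ (All.zipWith
      (λ (p , _ , q) → m+n≤o⇒m≤o∸n k p , ≤-trans (m∸n≤m _ s) q) (init (τ ++ʷ τ′) high , init (τ ++ʷ τ′) rτ)))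
    -- As `x` changes level it has an edge, so the start of `ω` is listed in the tails of the whole
    -- walk.
    A = proj₁ (tails-via x u≢k)
    h∈ : h ∈ inits ω
    h∈ = subst (h ∈_) (sym (inits-++ (σ ++ʷ τ))) (∈-++⁺ʳ (inits (σ ++ʷ τ)) h∈′)
      where
      h∈′ : h ∈ inits (τ′ ++ʷ σ′)
      h∈′ = start-∈ (τ′ ++ʷ σ′) λ h≡k → k≢ (≤-antisym (m≤m+n k s)
        (≤-trans (All.lookup high (joint-∈ τ)) (≤-reflexive h≡k)))
    k∈ : k ∈ inits ω
    k∈ = subst (k ∈_) (sym (inits-++ (σ ++ʷ τ))) (∈-++⁺ˡ
      (subst (k ∈_) (sym (inits-++ σ)) (∈-++⁺ˡ (start-∈ σ k≢))))
    tails≡A : ∀ (γ : Walk G (a , k) (b , k)) → tails (x ++ʷ (γ ++ʷ y)) ≡ A ++ (inits γ ++ full y)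
    tails≡A γ = trans (proj₂ (tails-via x u≢k) (γ ++ʷ y)) (cong (A ++_) (full-++ γ))
    good : Good (tails (x ++ʷ (τ₁ ++ʷ y)))
    good = subst Good (sym (tails≡A τ₁)) (Good-shrink A (inits ω) (inits τ₁) (full y) h≤k+K
      (init ω mW) k∈ h∈ rτ₁ (subst Good (tails≡A ω) gρ))
    full≡A : ∀ (γ : Walk G (a , k) (b , k)) → full (x ++ʷ (γ ++ʷ y)) ≡ inits x ++ (inits γ ++ full y)
    full≡A γ = trans (full-++ x) (cong (inits x ++_) (full-++ γ))
    bounds : All (_≤ n) (full (x ++ʷ (τ₁ ++ʷ y)))
    bounds with subst (All _) (full≡A ω) bρ
    ... | bs = subst (All _) (sym (full≡A τ₁)) (++⁺ (++⁻ˡ (inits x) bs) (++⁺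
      (All.map (λ r → ≤-trans (proj₂ r) (All.lookup (++⁻ˡ (inits ω) (++⁻ʳ (inits x) bs)) h∈)) rτ₁)
      (++⁻ʳ (inits ω) (++⁻ʳ (inits x) bs))))
    lenω : len ω ≡ len σ + (len τ₁ + len σ′)
    lenω = trans (cong len ω-assoc) (trans (len-++ σ) (cong (len σ +_)
      (trans (len-++ (τ ++ʷ τ′)) (cong (_+ len σ′) (sym (len≡ cτ))))))
    shorter : len (x ++ʷ (τ₁ ++ʷ y)) < len (x ++ʷ (ω ++ʷ y))
    shorter = begin-strict
      len (x ++ʷ (τ₁ ++ʷ y))        ≡⟨ trans (len-++ x) (cong (len x +_) (len-++ τ₁)) ⟩
      len x + (len τ₁ + len y)      <⟨ +-monoʳ-< (len x) (+-monoˡ-< (len y) less) ⟩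
      len x + (len ω + len y)       ≡⟨ trans (len-++ x) (cong (len x +_) (len-++ ω)) ⟨
      len (x ++ʷ (ω ++ʷ y))         ∎
      where
      open ≤-Reasoning
      less : len τ₁ < len ω
      less = begin-strict
        len τ₁                        ≤⟨ m≤m+n _ (len σ′) ⟩
        len τ₁ + len σ′               <⟨ +-monoˡ-< (len τ₁ + len σ′) (nonempty σ k≢) ⟩
        len σ + (len τ₁ + len σ′)     ≡⟨ lenω ⟨
        len ω                         ∎
    costω : cost ω ≡ (cost σ +ℤ cost σ′) +ℤ cost τ₁
    costω = begin
      cost ω                                 ≡⟨ cong cost ω-assoc ⟩
      cost (σ ++ʷ ((τ ++ʷ τ′) ++ʷ σ′))       ≡⟨ cost-++ σ ⟩
      cost σ +ℤ cost ((τ ++ʷ τ′) ++ʷ σ′)     ≡⟨ cong (cost σ +ℤ_) (cost-++ (τ ++ʷ τ′)) ⟩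
      cost σ +ℤ (cost (τ ++ʷ τ′) +ℤ cost σ′) ≡⟨ cong (λ c → cost σ +ℤ (c +ℤ cost σ′)) (cost≡ cτ) ⟨
      cost σ +ℤ (cost τ₁ +ℤ cost σ′)         ≡⟨ cong (cost σ +ℤ_) (ℤP.+-comm (cost τ₁) (cost σ′)) ⟩
      cost σ +ℤ (cost σ′ +ℤ cost τ₁)         ≡⟨ ℤP.+-assoc (cost σ) _ _ ⟨
      (cost σ +ℤ cost σ′) +ℤ cost τ₁         ∎
      where open ≡-Reasoning
    cheaper : cost (x ++ʷ (τ₁ ++ʷ y)) ≤ℤ cost (x ++ʷ (ω ++ʷ y))
    cheaper = begin
      cost (x ++ʷ (τ₁ ++ʷ y))            ≡⟨ trans (cost-++ x) (cong (cost x +ℤ_) (cost-++ τ₁)) ⟩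
      cost x +ℤ (cost τ₁ +ℤ cost y)      ≤⟨ ℤP.+-monoʳ-≤ (cost x) (ℤP.+-monoˡ-≤ (cost y) less) ⟩
      cost x +ℤ (cost ω +ℤ cost y)       ≡⟨ trans (cost-++ x) (cong (cost x +ℤ_) (cost-++ ω)) ⟨
      cost (x ++ʷ (ω ++ʷ y))             ∎
      where
      open ℤP.≤-Reasoning
      less : cost τ₁ ≤ℤ cost ω
      less = begin
        cost τ₁                          ≡⟨ ℤP.+-identityˡ (cost τ₁) ⟨
        0ℤ +ℤ cost τ₁                    ≤⟨ ℤP.+-monoˡ-≤ (cost τ₁) nonneg ⟩
        (cost σ +ℤ cost σ′) +ℤ cost τ₁   ≡⟨ costω ⟨
        cost ω                           ∎

  -- After its last visit to `k + s` the ascent never returns to `k`, so the last visit to `k` comes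
  -- earlier; dually on the descent. The shared states `a` and `b` make the pieces in between cycles
  -- up to the shift by `s`, and the sign of their total cost decides between cutting and repeating.
  resolve : ∀ {c k s u v w b} (α : Walk G u c) (β : Walk G c v) (B : Walk G v w) →
    LastVisit k α a → LastVisit (k + s) α a → FirstVisit k β b → FirstVisit (k + s) β b →
    pos u < k → pos v < k → K + pos v < pos c → 0 < s → k + s ≤ pos c → pos c ≤ k + K →
    All (_≤ pos c) (full (α ++ʷ β)) → All Mid (full (α ++ʷ β)) →
    All (_≤ n) (full ((α ++ʷ β) ++ʷ B)) → Good (inits (α ++ʷ β)) → Good (tails ((α ++ʷ β) ++ʷ B)) →
    Improved G u w (cost ((α ++ʷ β) ++ʷ B)) (len ((α ++ʷ β) ++ʷ B))
  resolve {G = G} {c = i , h} {k} {s} {u} {v} α β B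
    (lastly x α₁ refl α₁≥) (lastly x₁ τ eqα τ≥) (firstly β₁ y β≡ β₁≥) (firstly τ′ y₁ eqβ τ′≥)
    u<k v<k v≪h 0<s k+s≤h h≤k+K ≤h mid bρ gI gT
    with compare-splits x x₁ eqα | compare-splits τ′ β₁ (trans (sym eqβ) β≡)
  -- The other order would put a vertex of level `k` into a part that stays at `k + s` or above.
  ... | inj₂ (γ , _ , refl) | _ = ⊥-elim (m+1+n≰m k (≤-trans (+-monoʳ-≤ k 0<s) (All.lookup τ≥ (joint-∈ γ))))
  ... | inj₁ _ | inj₂ (γ , refl , _) = ⊥-elim (m+1+n≰m k (≤-trans (+-monoʳ-≤ k 0<s) (All.lookup τ′≥ (joint-∈ β₁))))
  ... | inj₁ (σ , _ , refl) | inj₁ (σ′ , refl , _) with β≡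
  ...   | refl = conclude (ℤP.≤-total 0ℤ (cost σ +ℤ cost σ′))
    where
    α′ = σ ++ʷ τ
    β′ = τ′ ++ʷ σ′
    ω = α′ ++ʷ β′
    Y = y ++ʷ B
    ρ-assoc : ((x ++ʷ α′) ++ʷ (β′ ++ʷ y)) ++ʷ B ≡ x ++ʷ (ω ++ʷ Y)
    ρ-assoc = begin
      ((x ++ʷ α′) ++ʷ (β′ ++ʷ y)) ++ʷ B ≡⟨ ++ʷ-assoc (x ++ʷ α′) (β′ ++ʷ y) B ⟩
      (x ++ʷ α′) ++ʷ ((β′ ++ʷ y) ++ʷ B) ≡⟨ cong ((x ++ʷ α′) ++ʷ_) (++ʷ-assoc β′ y B) ⟩
      (x ++ʷ α′) ++ʷ (β′ ++ʷ Y)         ≡⟨ ++ʷ-assoc x α′ _ ⟩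
      x ++ʷ (α′ ++ʷ (β′ ++ʷ Y))         ≡⟨ cong (x ++ʷ_) (++ʷ-assoc α′ β′ Y) ⟨
      x ++ʷ (ω ++ʷ Y)                   ∎
      where open ≡-Reasoning
    inner : ∀ {P : ℕ → Set} → All P (full ((x ++ʷ α′) ++ʷ (β′ ++ʷ y))) → All P (full α′) × All P (full β′)
    inner ps = let p , q = split-All (x ++ʷ α′) ps in proj₂ (split-All x p) , proj₁ (split-All β′ q)
    full-ω : ∀ {P : ℕ → Set} → All P (full α′) → All P (full β′) → All P (full ω)
    full-ω p q = subst (All _) (cong (_ ∷_) (sym (tails-++ α′))) (++⁺ p (All.tail q))
    rα : All (Range k h) (full α′)
    rα = All.zip (α₁≥ , proj₁ (inner ≤h))
    rβ : All (Range k h) (full β′)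
    rβ = All.zip (β₁≥ , proj₂ (inner ≤h))
    bρ′ : All (_≤ n) (full (x ++ʷ (ω ++ʷ Y)))
    bρ′ = subst (λ ρ → All (_≤ n) (full ρ)) ρ-assoc bρ
    h+K≤n : h + K ≤ n
    h+K≤n = proj₂ (All.lookup mid (joint-∈ (x ++ʷ α′)))
    k≤h : k ≤ h
    k≤h = m+n≤o⇒m≤o k k+s≤h
    climb≡ : full (x ++ʷ α′) ≡ (inits x ++ inits σ) ++ full τ
    climb≡ = trans (full-++ x) (trans (cong (inits x ++_) (full-++ σ)) (sym (++-assoc (inits x) (inits σ) (full τ))))
    ubx : ∀ {z} → S₁ z (inits x ++ inits σ) → z ≤ h
    ubx q = All.lookup (++⁻ˡ (inits x ++ inits σ) (subst (All (_≤ h)) climb≡ (proj₁ (split-All (x ++ʷ α′) ≤h)))) (S₁-∈ q)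
    gx : Good ((inits x ++ inits σ) ++ full τ)
    -- The descent ends below the summit and so has an edge; hence the whole ascent, summit
    -- included, lies in the good `inits`.
    gx with inits-via (β′ ++ʷ y) (λ h≡ → <-irrefl (sym h≡) (<-≤-trans v<k k≤h))
    ... | C , eq = subst Good climb≡ (Good-++⁻ˡ _ C (subst Good (eq (x ++ʷ α′)) gI))
    gD : Good (full ((β′ ++ʷ y) ++ʷ B))
    gD with tails-via (x ++ʷ α′) (<⇒≢ (<-≤-trans u<k k≤h))
    ... | A , eq = Good-++⁻ʳ A (subst Good (eq ((β′ ++ʷ y) ++ʷ B))
      (subst (λ ρ → Good (tails ρ)) (++ʷ-assoc (x ++ʷ α′) (β′ ++ʷ y) B) gT))
    tailsD : tails ((β′ ++ʷ y) ++ʷ B) ≡ tails τ′ ++ (tails σ′ ++ tails Y)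
    tailsD = begin
      tails ((β′ ++ʷ y) ++ʷ B)            ≡⟨ cong tails (trans (++ʷ-assoc β′ y B) (++ʷ-assoc τ′ σ′ Y)) ⟩
      tails (τ′ ++ʷ (σ′ ++ʷ Y))           ≡⟨ tails-++ τ′ ⟩
      tails τ′ ++ tails (σ′ ++ʷ Y)        ≡⟨ cong (tails τ′ ++_) (tails-++ σ′) ⟩
      tails τ′ ++ (tails σ′ ++ tails Y)   ∎
      where open ≡-Reasoning
    after-summit : ∀ {P : ℕ → Set} → All P (full ((x ++ʷ α′) ++ʷ (β′ ++ʷ y))) → All P (full (β′ ++ʷ y))
    after-summit ps = proj₂ (split-All (x ++ʷ α′) ps)
    -- A middle entry of B above h would form a valley with the summit and the end of β.
    uby : ∀ {z} → P₁ z (tails σ′ ++ tails Y) → z ≤ h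
    uby {z} q with P₁-++⁻ (tails (β′ ++ʷ y)) (subst (P₁ z) shape (P₁-++⁺ʳ midτ′ q))
      where
      midτ′ = All.tail (proj₁ (split-All τ′ (proj₂ (inner mid))))
      shape : tails τ′ ++ (tails σ′ ++ tails Y) ≡ tails (β′ ++ʷ y) ++ tails B
      shape = trans (sym tailsD) (tails-++ (β′ ++ʷ y))
    ... | inj₁ q′ = All.lookup (All.tail (after-summit ≤h)) (P₁-∈ q′)
    ... | inj₂ (ms , q′) = ≮⇒≥ λ h<z → gD (h , pos v , z ,
      here (All.head (after-summit mid)) (subst (P₂ _ _) (sym (tails-++ (β′ ++ʷ y)))
        (P₂-++⁺ ms (end-∈ (β′ ++ʷ y) (λ h≡ → <-irrefl (sym h≡) (<-≤-trans v<k k≤h))) q′)) ,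
      inj₂ (v≪h , <-trans v≪h h<z))
    pumped : cost σ +ℤ cost σ′ ≤ℤ 0ℤ → Normalised G _ _ (cost (x ++ʷ (σ ++ʷ (τ ++ʷ (τ′ ++ʷ (σ′ ++ʷ Y))))))
    pumped = pump (suc n) x σ τ τ′ σ′ Y (m≤n+m (suc n) h) (m+n≤o⇒m≤o h h+K≤n) 0<s
      (+-cancelˡ-≤ k s K (≤-trans k+s≤h h≤k+K))
      (proj₁ (All.lookup (proj₁ (inner mid)) (here refl))) h≤k+K
      (subst (All _) (full-++ σ) rα) (subst (All _) (cong (h ∷_) (tails-++ τ′)) rβ)
      (++⁻ˡ (inits x) (subst (All _) (full-++ x) bρ′))
      (All.tail (proj₂ (split-All ω (proj₂ (split-All x bρ′)))))
      ubx uby gx (subst Good (cong (h ∷_) tailsD) gD)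
    conclude : 0ℤ ≤ℤ cost σ +ℤ cost σ′ ⊎ cost σ +ℤ cost σ′ ≤ℤ 0ℤ → _
    conclude (inj₁ nonneg) = subst (λ ρ → Improved G _ _ (cost ρ) (len ρ)) (sym ρ-assoc) (shrink x σ τ τ′ σ′ Y
      (<⇒≢ u<k) 0<s h≤k+K
      (full-ω rα rβ) (full-ω (proj₁ (inner mid)) (proj₂ (inner mid)))
      (subst (All _) (cong (_ ∷_) (sym (tails-++ τ))) (++⁺ τ≥ (All.tail τ′≥)))
      bρ′ (subst (λ ρ → Good (tails ρ)) ρ-assoc gT) nonneg)
    conclude (inj₂ neg) with pumped neg
    ... | ρ , bs , w , g = ρ , bs , subst (cost ρ ≤ℤ_) (cong cost (sym (trans ρ-assoc flatten))) w , inj₁ g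
      where
      flatten : x ++ʷ (ω ++ʷ Y) ≡ x ++ʷ (σ ++ʷ (τ ++ʷ (τ′ ++ʷ (σ′ ++ʷ Y))))
      flatten = cong (x ++ʷ_) (trans (++ʷ-assoc α′ β′ Y)
        (trans (++ʷ-assoc σ τ _) (cong (λ γ → σ ++ʷ (τ ++ʷ γ)) (++ʷ-assoc τ′ σ′ Y))))

  -- Among the K + 1 topmost levels below the summit, two share the states in which they
  -- are last left before the summit and first reached after it.
  flatten-peak : ∀ {y w} (θ : Walk G u v) (B : Walk G v w) → All Mid (full θ) → All (_≤ n) (full (θ ++ʷ B)) →
    Good (inits θ) → Good (tails (θ ++ʷ B)) → y ∈ full θ → Peak (pos u) y (pos v) →
    Improved G u w (cost (θ ++ʷ B)) (len (θ ++ʷ B))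
  flatten-peak {G = G} {u} {v} {y} θ B mid bρ gI gT y∈ (u≪y , v≪y) with summitSplit θ
  ... | summit {_ , h} α β refl ≤h =
    -- A pair of states takes one of `N * N = K` values, one fewer than there are levels.
    let j , j′ , j<j′ , eq = pigeonhole (n<1+n K) (λ j → combine (proj₁ (rise j)) (proj₁ (fall j)))
        eqa , eqb = combine-injective (proj₁ (rise j)) (proj₁ (fall j)) (proj₁ (rise j′)) (proj₁ (fall j′)) eq
        s = toℕ j′ ∸ toℕ j
        level+s : level j′ ≡ level j + s
        level+s = trans (cong (base +_) (sym (m+[n∸m]≡n (<⇒≤ j<j′)))) (sym (+-assoc base (toℕ j) s))
    in resolve α β B
      (proj₂ (rise j))
      (subst (λ l → LastVisit l α (proj₁ (rise j))) level+s
        (subst (LastVisit (level j′) α) (sym eqa) (proj₂ (rise j′))))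
      (proj₂ (fall j))
      (subst (λ l → FirstVisit l β (proj₁ (fall j))) level+s
        (subst (FirstVisit (level j′) β) (sym eqb) (proj₂ (fall j′))))
      (far u≪y j) (far v≪y j) (<-≤-trans v≪y y≤h) (m<n⇒0<n∸m j<j′)
      (subst (_≤ h) level+s (level≤h j′))
      (≤-trans (≤-reflexive (sym base+K)) (+-monoˡ-≤ K (m≤m+n base (toℕ j))))
      ≤h mid bρ gI gT
    where
    base = h ∸ K
    y≤h = All.lookup ≤h y∈
    level : Fin (suc K) → ℕ
    level j = base + toℕ j
    base+K : base + K ≡ h
    base+K = m∸n+n≡m (≤-trans (m≤m+n K (pos u)) (<⇒≤ (<-≤-trans u≪y y≤h)))
    level≤h : ∀ j → level j ≤ h
    level≤h j = ≤-trans (+-monoʳ-≤ base (≤-pred (toℕ<n j))) (≤-reflexive base+K)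
    -- The summit exceeds both ends by more than `K`, so even the lowest level `h ∸ K` lies above
    -- them and is met on either side.
    far : ∀ {p} → K + p < y → ∀ j → p < level j
    far {p} p≪y j = <-≤-trans (+-cancelˡ-< K p base (<-≤-trans p≪y
      (≤-trans y≤h (≤-reflexive (trans (sym base+K) (+-comm base K)))))) (m≤m+n base (toℕ j))
    rise : ∀ j → ∃ (LastVisit (level j) α)
    rise j with lastVisit (level j) α (level≤h j)
    ... | inj₁ visit = visit
    ... | inj₂ (above ∷ _) = ⊥-elim (<-asym above (far u≪y j))
    fall : ∀ j → ∃ (FirstVisit (level j) β)
    fall j with firstVisit (level j) β (level≤h j)
    ... | inj₁ visit = visit
    ... | inj₂ above = ⊥-elim (<-asym (All.lookup above (end-∈-full β)) (far v≪y j))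

  -- Valleys by reflection.

  Mid-mirrored : ∀ {p} → Mid p → Mid (n ∸ p)
  Mid-mirrored {p} (K≤p , p+K≤n) = m+n≤o⇒m≤o∸n K (≤-trans (≤-reflexive (+-comm K p)) p+K≤n) ,
    ≤-trans (+-monoʳ-≤ (n ∸ p) K≤p) (≤-reflexive (m∸n+n≡m (m+n≤o⇒m≤o p p+K≤n)))

  far-mirrored : ∀ {p q} → p ≤ n → q ≤ n → K + p < q → K + (n ∸ q) < n ∸ p
  far-mirrored {p} {q} p≤n q≤n p≪q = far-mirror (m∸n≤m n p) (m∸n≤m n q)
    (subst (λ q → K + (n ∸ (n ∸ p)) < q) (sym (m∸[m∸n]≡n q≤n))
      (subst (λ p → K + p < q) (sym (m∸[m∸n]≡n p≤n)) p≪q))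

  mirror-≤ : ∀ l → All (_≤ n) (map (n ∸_) l)
  mirror-≤ l = map⁺ (All.universal (m∸n≤m n) l)

  flatten-valley : ∀ {y w} (θ : Walk G u v) (B : Walk G v w) → All Mid (full θ) → All (_≤ n) (full (θ ++ʷ B)) →
    Good (inits θ) → Good (tails (θ ++ʷ B)) → y ∈ full θ → Valley (pos u) y (pos v) →
    Improved G u w (cost (θ ++ʷ B)) (len (θ ++ʷ B))
  flatten-valley {G = G} {u} {v} {y} {w} θ B mid bρ gI gT y∈ (u≫y , v≫y)
    with split-All θ bρ
  ... | bθ , bB with mirror n θ bθ | mirror n B bB
  ...   | θ′ , cθ | B′ , cB with flatten-peak θ′ B′
            (subst (All Mid) (sym (full≡ cθ)) (map⁺ (All.map Mid-mirrored mid)))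
            (subst (All (_≤ n)) (sym full′≡) (mirror-≤ (full (θ ++ʷ B))))
            (subst Good (sym (inits≡ cθ)) (Good-mirror (++⁻ˡ (inits θ) (subst (All _) (full-∷ʳ θ) bθ)) gI))
            (subst Good (sym tails′≡) (Good-mirror (All.tail bρ) gT))
            (subst (n ∸ y ∈_) (sym (full≡ cθ)) (∈-map⁺ (n ∸_) y∈))
            (far-mirrored {y} {pos u} y≤n u≤n u≫y , far-mirrored {y} {pos v} y≤n v≤n v≫y)
    where
    u≤n = All.head bθ
    v≤n = All.lookup bθ (end-∈-full θ)
    y≤n = All.lookup bθ y∈
    tails′≡ : tails (θ′ ++ʷ B′) ≡ map (n ∸_) (tails (θ ++ʷ B))
    tails′≡ = begin
      tails (θ′ ++ʷ B′)                               ≡⟨ tails-++ θ′ ⟩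
      tails θ′ ++ tails B′                            ≡⟨ cong₂ _++_ (tails≡ cθ) (tails≡ cB) ⟩
      map (n ∸_) (tails θ) ++ map (n ∸_) (tails B)    ≡⟨ map-++ (n ∸_) (tails θ) (tails B) ⟨
      map (n ∸_) (tails θ ++ tails B)                 ≡⟨ cong (map (n ∸_)) (tails-++ θ) ⟨
      map (n ∸_) (tails (θ ++ʷ B))                    ∎
      where open ≡-Reasoning
    full′≡ : full (θ′ ++ʷ B′) ≡ map (n ∸_) (full (θ ++ʷ B))
    full′≡ = cong (n ∸ pos u ∷_) tails′≡
  ...     | ρ′ , bρ′ , w′ , result with mirror n ρ′ bρ′
  -- Taking `opposite` twice gives back `G` definitionally, whereas the endpoints return only by
  -- `n ∸ (n ∸ p) ≡ p`.
  ...       | ρ , c = subst₂ (λ u w → Improved G u w (cost (θ ++ʷ B)) (len (θ ++ʷ B)))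
    (twice (All.head bρ)) (twice (All.lookup bB (end-∈-full B)))
    ( ρ
    , subst (All (_≤ n)) (sym (full≡ c)) (mirror-≤ (full ρ′))
    , ℤP.≤-trans (ℤP.≤-reflexive (cost≡ c)) (ℤP.≤-trans w′ (ℤP.≤-reflexive
        (trans (cost-++ θ′) (trans (cong₂ _+ℤ_ (cost≡ cθ) (cost≡ cB)) (sym (cost-++ θ))))))
    , back result)
    where
    twice : ∀ {u} → pos u ≤ n → at (n ∸_) (at (n ∸_) u) ≡ u
    twice u≤n = cong (_ ,_) (m∸[m∸n]≡n u≤n)
    back : Good (full ρ′) ⊎ (Good (tails ρ′) × len ρ′ < len (θ′ ++ʷ B′)) →
      Good (full ρ) ⊎ (Good (tails ρ) × len ρ < len (θ ++ʷ B))
    back (inj₁ g) = inj₁ (subst Good (sym (full≡ c)) (Good-mirror bρ′ g))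
    back (inj₂ (g , l)) = inj₂ (subst Good (sym (tails≡ c)) (Good-mirror (All.tail bρ′) g) ,
      subst₂ _<_ (sym (len≡ c)) (trans (len-++ θ′) (trans (cong₂ _+_ (len≡ cθ) (len≡ cB)) (sym (len-++ θ)))) l)

  -- The shortest bad prefix and the induction.

  record FirstBad (ρ : Walk G u v) : Set where
    constructor firstBad
    field
      {stop} : Vertex N
      prefix : Walk G u stop
      rest : Walk G stop v
      split≡ : ρ ≡ prefix ++ʷ rest
      good : Good (inits prefix)
      bad : Bad (full prefix)

  find-bad : (α : Walk G u t) (β : Walk G t v) → Good (inits α) → Good (full (α ++ʷ β)) ⊎ FirstBad (α ++ʷ β)
  find-bad α β g with Bad? (full α)
  ... | yes bad = inj₂ (firstBad α β refl g bad)
  find-bad α [] g | no good = inj₁ (subst (λ α → Good (full α)) (sym (++ʷ-[] α)) good)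
  find-bad {G = G} {u = u} {v = v} α (e ∷ β) g | no good =
    subst (λ ρ → Good (full ρ) ⊎ FirstBad ρ) (++ʷ-assoc α (e ∷ []) β)
      (find-bad (α ++ʷ (e ∷ [])) β (subst Good (trans (full-∷ʳ α) (sym (inits-++ α))) good))

  -- A bad triple that missed the first or the last entry would survive its deletion. It therefore
  -- starts at `p` and ends at `q`, and its middle block is the entire list.
  Bad-minimal : ∀ p A q → Good (p ∷ A) → Good (A ++ [ q ]) → Bad (p ∷ A ++ [ q ]) →
    All Mid (p ∷ A ++ [ q ]) × ∃ λ y → y ∈ p ∷ A ++ [ q ] × (Peak p y q ⊎ Valley p y q)
  Bad-minimal p A q gI gT (x , y , z , t , bad) with Tri-++⁻ (p ∷ A) t
  ... | left s = ⊥-elim (gI (x , y , z , s , bad))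
  ... | right (here _ ())
  ... | right (there ())
  ... | one-two _ (here _ ())
  ... | one-two _ (there _ ())
  ... | two-one (there s) r = ⊥-elim (gT (x , y , z , Tri-++⁺₂₁ s r , bad))
  ... | two-one (here m ms i) (here m′) = m ∷ ++⁺ ms (m′ ∷ []) , y , there (∈-++⁺ˡ i) , bad

  improve : (ρ : Walk G u v) → All (_≤ n) (full ρ) → Good (tails ρ) → FirstBad ρ → Improved G u v (cost ρ) (len ρ)
  improve _ bs gT (firstBad [] B refl g (_ , _ , _ , here _ () , _))
  improve _ bs gT (firstBad [] B refl g (_ , _ , _ , there () , _))
  improve {u = u} _ bs gT (firstBad {stop} θ@(_ ∷ θ′) B refl g bad)
    with Bad-minimal (pos u) (inits θ′) (pos stop) g
      -- Without its first vertex the prefix is part of the good `tails`.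
      (subst Good (full-∷ʳ θ′) (Good-++⁻ˡ (full θ′) (tails B) (subst Good (tails-++ θ) gT)))
      (subst Bad (full-∷ʳ θ) bad)
  ... | mid , y , y∈ , bad′ = [ flatten-peak θ B mid′ bs g gT y∈′ , flatten-valley θ B mid′ bs g gT y∈′ ]′ bad′
    where
    mid′ = subst (All Mid) (sym (full-∷ʳ θ)) mid
    y∈′ = subst (y ∈_) (sym (full-∷ʳ θ)) y∈

  -- Cutting shortens the walk and keeps its `tails` good, so the recursion on the length goes on;
  -- repeating the cycles ends it at once.
  repair : ∀ fuel (ρ : Walk G u v) → len ρ < fuel → All (_≤ n) (full ρ) → Good (tails ρ) → Normalised G u v (cost ρ)
  repair (suc fuel) ρ l bs g with find-bad [] ρ (λ { (_ , _ , _ , () , _) })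
  ... | inj₁ good = ρ , bs , ℤP.≤-refl , good
  ... | inj₂ fb with improve ρ bs g fb
  ...   | ρ₁ , bs₁ , w₁ , inj₁ good = ρ₁ , bs₁ , w₁ , good
  ...   | ρ₁ , bs₁ , w₁ , inj₂ (g₁ , l₁) with repair fuel ρ₁ (<-≤-trans l₁ (≤-pred l)) bs₁ g₁
  ...     | ρ₂ , bs₂ , w₂ , good = ρ₂ , bs₂ , ℤP.≤-trans w₂ w₁ , good

  -- The walk after the first edge is normalised first, which supplies the hypothesis on `tails` in
  -- `repair`.
  normalise : (ρ : Walk G u v) → All (_≤ n) (full ρ) → Normalised G u v (cost ρ)
  normalise [] bs = [] , bs , ℤP.≤-refl , λ { (_ , _ , _ , here _ () , _) ; (_ , _ , _ , there () , _) }
  normalise (_∷_ {c = c} e ρ) (b ∷ bs) with normalise ρ bs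
  ... | ρ₁ , bs₁ , w₁ , good with repair _ (e ∷ ρ₁) (n<1+n _) (b ∷ bs₁) good
  ...   | ρ₂ , bs₂ , w₂ , good₂ = ρ₂ , bs₂ , ℤP.≤-trans w₂ (ℤP.+-monoʳ-≤ c w₁) , good₂

-- Passage between paths and walks.

module Unfolding {N : ℕ} (R : DBC N) (n : ℕ) where

  open Normalisation {N} n using (K)
  open Windows K n
  open Walks {N}

  private variable
    u v t : Vertex N

  graph : Graph N
  graph = record
    { Flat = λ i j c → (unp i , unp j , c) ∈ R
    ; Up   = λ i j c → (unp i , pr j , c) ∈ R
    ; Down = λ i j c → (pr i , unp j , c) ∈ R
    }

  edge⇒step : ∀ {c} → Balanced R → Edge R n u c v → Step graph u c v × pos u ≤ n
  edge⇒step bal (p , p<n , unp i , unp j , m , refl , refl) = flat m , <⇒≤ p<n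
  edge⇒step bal (p , p<n , unp i , pr j , m , refl , refl) = up m refl , <⇒≤ p<n
  edge⇒step bal (p , p<n , pr i , unp j , m , refl , refl) = down m refl , p<n
  -- Balance turns an atom between primed variables into one between unprimed variables, that is, a
  -- flat step at level `suc p`.
  edge⇒step bal (p , p<n , pr i , pr j , m , refl , refl) = flat (proj₂ (bal i j _) m) , p<n

  path⇒walk : Balanced R → (ρ : Path R n u v) → Σ (Walk graph u v) λ ω → cost ω ≡ weight ρ × All (_≤ n) (full ω)
  path⇒walk bal ([] b) = [] , refl , b ∷ []
  path⇒walk bal (_∷_ {c = c} e ρ) with edge⇒step bal e | path⇒walk bal ρ
  ... | s , b | ω , w , bs = s ∷ ω , cong (c +ℤ_) w , b ∷ bs

  -- Level n only carries the primed copies of the atoms between equal levels.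
  step⇒edge : ∀ {c} → Balanced R → 1 ≤ n → Step graph u c v → pos u ≤ n → pos v ≤ n → Edge R n u c v
  step⇒edge bal 1≤n (flat {i = i} {j} m) u≤ _ with m≤n⇒m<n∨m≡n u≤
  ... | inj₁ p<n = _ , p<n , unp i , unp j , m , refl , refl
  step⇒edge bal (s≤s _) (flat {i = i} {j} m) _ _ | inj₂ refl = _ , ≤-refl , pr i , pr j , proj₁ (bal i j _) m , refl , refl
  step⇒edge bal _ (up m refl) _ v≤ = _ , v≤ , unp _ , pr _ , m , refl , refl
  step⇒edge bal _ (down m refl) u≤ _ = _ , u≤ , pr _ , unp _ , m , refl , refl

  walk⇒path : Balanced R → 1 ≤ n → (ω : Walk graph u v) → All (_≤ n) (full ω) →
    Σ (Path R n u v) λ ρ → weight ρ ≡ cost ω × positions ρ ≡ full ω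
  walk⇒path bal 1≤n [] (b ∷ []) = [] b , refl , refl
  walk⇒path bal 1≤n (_∷_ {c = c} s ω) (b ∷ bs) with walk⇒path bal 1≤n ω bs
  ... | ρ , w , ps = step⇒edge bal 1≤n s b (All.head bs) ∷ ρ , cong (c +ℤ_) w , cong (_ ∷_) ps

  -- Long corners contain bad triples.

  positions-prefix : (α : Path R n t u) → Σ (List ℕ) λ A → ∀ {v} (β : Path R n u v) → positions (α ++ₚ β) ≡ A ++ positions β
  positions-prefix ([] _) = [] , λ _ → refl
  positions-prefix (_ ∷ α) with positions-prefix α
  ... | A , eq = _ ∷ A , λ β → cong (_ ∷_) (eq β)

  positions-suffix : (α : Path R n t u) (β : Path R n u v) → Σ (List ℕ) λ B → positions (α ++ₚ β) ≡ positions α ++ B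
  positions-suffix ([] _) ([] _) = [] , refl
  positions-suffix ([] _) (_ ∷ β) = positions β , refl
  positions-suffix (_ ∷ α) β with positions-suffix α β
  ... | B , eq = B , cong (_ ∷_) eq

  positions-last : (α : Path R n t u) → Σ (List ℕ) λ A → positions α ≡ A ++ [ pos u ]
  positions-last ([] _) = [] , refl
  positions-last (_ ∷ α) with positions-last α
  ... | A , eq = _ ∷ A , cong (_ ∷_) eq

  -- The two ends of a corner share a level, and a vertex on any other level lies strictly between
  -- them.
  corner-Tri : ∀ {p} (θ : Path R n u v) → Corner θ → All Mid (positions θ) → p ∈ positions θ → p ≢ pos u →
    Tri (pos u) p (pos u) (positions θ)
  corner-Tri (e ∷ θ) (_ , eq) (m ∷ ms) (here refl) p≢ = ⊥-elim (p≢ refl)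
  corner-Tri (e ∷ θ) (_ , eq) (m ∷ ms) (there i) p≢ with positions-last θ
  ... | A , eqA rewrite eqA | eq with ∈-++⁻ A i
  ...   | inj₂ (here refl) = ⊥-elim (p≢ refl)
  ...   | inj₁ j = Tri-++⁺₂₁ (here m (++⁻ˡ A ms) j) (here m)

  -- The extreme level of the corner is `d` away from both ends, and `d` exceeds `K`.
  long-corner-Bad : (θ : Path R n u v) → All Mid (positions θ) → LongCorner θ → Bad (positions θ)
  long-corner-Bad {u = u} θ ms (d , K<d , inj₁ (corner , range)) =
    pos u , pos u + d , pos u ,
    corner-Tri θ corner ms (proj₂ (range _) (m≤m+n _ d , ≤-refl))
      (λ eq → <-irrefl (sym eq) far′) , inj₁ (far , far)
    where
    far : K + pos u < pos u + d
    far = <-≤-trans (+-monoˡ-< (pos u) K<d) (≤-reflexive (+-comm d (pos u)))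
    far′ : pos u < pos u + d
    far′ = ≤-<-trans (m≤n+m (pos u) K) far
  long-corner-Bad {u = u} θ ms (d , K<d , inj₂ (corner , d≤u , range)) =
    pos u , pos u ∸ d , pos u ,
    corner-Tri θ corner ms (proj₂ (range _) (m∸n≤m _ d , ≤-reflexive (sym (m∸n+n≡m d≤u))))
      (λ eq → <-irrefl eq far′) , inj₂ (far , far)
    where
    far : K + (pos u ∸ d) < pos u
    far = <-≤-trans (+-monoˡ-< (pos u ∸ d) K<d) (≤-reflexive (m+[n∸m]≡n d≤u))
    far′ : pos u ∸ d < pos u
    far′ = ≤-<-trans (m≤n+m (pos u ∸ d) K) far

  Good⇒Normalized : (ρ : Path R n u v) → Good (positions ρ) → Normalized ρ
  Good⇒Normalized _ good _ _ θ (α , β , refl) mid long with positions-prefix α | positions-suffix θ β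
  ... | A , eqA | B , eqB = long-corner-Good (long-corner-Bad θ (All.tabulate (mid _)) long)
    where
    long-corner-Good : Good (positions θ)
    long-corner-Good = Good-++⁻ˡ _ B (subst Good eqB (Good-++⁻ʳ A (subst Good (eqA (θ ++ₚ β)) good)))

theorem2 : ∀ (N : ℕ) (R : DBC N) → Balanced R → ∀ (n : ℕ) → 1 ≤ n →
    ∀ (u v : Vertex N) → Extremal n u → Extremal n v → (ρ : Path R n u v) →
    Σ (Path R n u v) λ ρ' → Normalized ρ' × Compatible ρ' ρ
theorem2 N R bal n 1≤n u v _ _ ρ =
  let ω , cost≡weight , bω = path⇒walk bal ρ
      ω′ , bω′ , cheaper , good = normalise ω bω
      ρ′ , weight≡cost , positions≡full = walk⇒path bal 1≤n ω′ bω′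
  in ρ′ , Good⇒Normalized ρ′ (subst Good (sym positions≡full) good) ,
     ℤP.≤-trans (ℤP.≤-reflexive weight≡cost) (ℤP.≤-trans cheaper (ℤP.≤-reflexive cost≡weight))
  where
  open Unfolding R n
  open Walks {N}
  open Normalisation {N} n
  open Windows K n
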